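{- Let $n$, $m$, $t$ be positive integers and let $k = mt$, where each prime divisor of $k$ also divides $t$. If $\mathrm{BH}(n,k)$ is nonempty, then $\mathrm{BH}(mn, t)$ is nonempty.
   Context: For positive integers $n,k$, $\mathrm{BH}(n,k)$ denotes the set of $n\times n$ Butson-Hadamard matrices: $n \times n$ complex matrices $H$ all of whose entries are complex $k^{\text{th}}$ roots of unity and which satisfy $HH^* = nI_n$, where $H^*$ is the conjugate transpose of $H$ and $I_n$ is the $n\times n$ identity matrix. -}

module Defs where

open import Level using (_⊔_)
open import Algebra.Bundles using (CommutativeRing)
open import Data.Nat using (ℕ; zero; suc; _∸_; _<_)
open import Data.Fin using (Fin; toℕ; _≟_)
open import Relation.Nullary using (yes; no)
open import Data.Product using (Σ; _×_)
open import Data.Sum using (_⊎_)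
open import Relation.Binary.PropositionalEquality using (_≡_)
open import Relation.Nullary using (¬_)

-- We work in an arbitrary commutative ring R; the statement quantifies over
-- all integral domains of characteristic 0 containing a primitive k-th root
-- of unity ζ.  (ℂ is one such; vanishing of a sum of powers of ζ is the same
-- in all of them, namely divisibility by the k-th cyclotomic polynomial.)
module _ {c ℓ} (R : CommutativeRing c ℓ) where
  open CommutativeRing R

  pow : Carrier → ℕ → Carrier
  pow x zero    = 1#
  pow x (suc e) = x * pow x e

  natR : ℕ → Carrier
  natR zero    = 0#
  natR (suc N) = 1# + natR N

  sumR : (n : ℕ) → (Fin n → Carrier) → Carrier
  sumR zero    f = 0#
  sumR (suc n) f = f Fin.zero + sumR n (λ j → f (Fin.suc j))

  record CharZeroDomain : Set (c ⊔ ℓ) where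
    field
      nontrivial   : ¬ (1# ≈ 0#)
      noZeroDivs   : ∀ x y → x * y ≈ 0# → (x ≈ 0#) ⊎ (y ≈ 0#)
      charZero     : ∀ N → ¬ (natR (suc N) ≈ 0#)

  record IsPrimitiveRoot (k : ℕ) (ζ : Carrier) : Set ℓ where
    field
      root      : pow ζ k ≈ 1#
      isPrimitive : ∀ j → 0 < j → j < k → ¬ (pow ζ j ≈ 1#)

  δ : ∀ {n} → ℕ → Fin n → Fin n → Carrier
  δ N i l with i ≟ l
  ... | yes _ = natR N
  ... | no  _ = 0#

  -- A k-th root of unity ζ^a (0 ≤ a < k) is encoded by its exponent a : Fin k
  -- (every k-th root of unity is such a power of the primitive root ζ).
  -- Its complex conjugate (= inverse) is ζ^(k - a).
  -- (H H^*)_{i l} = Σ_j ζ^(H i j) · conj(ζ^(H l j)).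
  HHstar : (k : ℕ) (ζ : Carrier) {n : ℕ} → (Fin n → Fin n → Fin k) → Fin n → Fin n → Carrier
  HHstar k ζ {n} H i l = sumR n (λ j → pow ζ (toℕ (H i j)) * pow ζ (k ∸ toℕ (H l j)))

  IsBH : (n k : ℕ) (ζ : Carrier) → (Fin n → Fin n → Fin k) → Set ℓ
  IsBH n k ζ H = ∀ i l → HHstar k ζ H i l ≈ δ n i l

  BHNonempty : (n k : ℕ) (ζ : Carrier) → Set ℓ
  BHNonempty n k ζ = Σ (Fin n → Fin n → Fin k) (IsBH n k ζ)

{-# OPTIONS --safe #-}

-- It suffices to treat m = p prime, since every prime factor of m divides t.  Let
-- ω = ζ^p, η = ζ^t and let C be the companion matrix of x^p - ω.  Replacing each
-- entry ζ^a of H by C^a F, with F the p × p Fourier matrix, gives a matrix with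
-- entries in the powers of ω.  Its Gram matrix vanishes off the diagonal because
-- that of H does so for all the Galois conjugates ζ η^u of ζ as well.
--
-- This last point, f(ζ) = 0 ⇒ f(ζ^(1+tu)) = 0 for integer polynomials f, needs no
-- minimal polynomials.  In ℤ[x]/(x^k - 1) the powers of f are linearly dependent,
-- which yields N ≠ 0 and b with N f = f² b, hence E = f b with E² = N E.  For a
-- prime q, N E(x^q) ≡ N E^q = N^q E ≡ N E modulo q; as the coefficients are bounded
-- independently of q, E(x^q) = E for all large q.  So E(ζ^U) = E(ζ) = 0, and thus
-- f(ζ^U) = 0, for every U without small prime factors, and the residue class of
-- 1 + tu modulo k contains such a U.
module Submission where

open import Defs
open import Algebra.Bundles using (CommutativeRing; CommutativeSemiring)
open import Algebra.Solver.Ring.AlmostCommutativeRing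
  using (fromCommutativeRing; _-Raw-AlmostCommutative⟶_)
open import Data.Empty using (⊥-elim)
open import Data.Fin using (Fin; toℕ; inject₁; fromℕ; fromℕ<; punchIn; combine; remQuot; _↑ˡ_; _↑ʳ_)
  renaming (_≟_ to _≟ᶠ_)
open import Data.Fin.Properties
  using (toℕ-inject₁; toℕ-fromℕ; toℕ<n; any?; toℕ-fromℕ<; toℕ-injective;
  punchInᵢ≢i; remQuot-combine; combine-remQuot; combine-injectiveˡ; combine-injectiveʳ)
open import Data.Integer using (ℤ; +_; -[1+_]; 0ℤ; _⊖_)
import Data.Integer as ℤ
import Data.Integer.Properties as ℤ
open import Data.Integer.Tactic.RingSolver using () renaming (solve-∀ to solveℤ-∀)
open import Data.List using ([]; _∷_)
open import Data.List.Relation.Unary.All using (All; []; _∷_)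
import Data.Maybe as Maybe
open import Data.Nat using (ℕ; zero; suc; NonZero; _!)
import Data.Nat as ℕ
import Data.Nat.Properties as ℕ
open import Data.Nat.Combinatorics using (_C_; nCk≡n!/k![n-k]!; k![n∸k]!∣n!; nCn≡1)
open import Data.Nat.Coprimality using (Coprime; coprime-Bézout)
open import Data.Nat.Divisibility using (_∣_; divides; ∣⇒≤; ∣1⇒≡1; m∣m*n; n∣m*n; ∣m⇒∣m*n; ∣n⇒∣m*n;
  ∣m+n∣m⇒∣n; _∣?_; quotient; m∣n⇒n≡quotient*m; m∣n⇒n≡m*quotient)
open import Data.Nat.DivMod
  using (_%_; _/_; _mod_; m/n*n≡m; m≡m%n+[m/n]*n; m%n<n; m<n⇒m%n≡m; m%n%n≡m%n;
  [m+kn]%n≡m%n; %-distribˡ-*; m%n*o≡m*o%[n*o])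
open import Data.Nat.GCD using (module Bézout)
open import Data.Nat.ListAction using (product)
open import Data.Nat.Primality using (Prime; euclidsLemma; prime⇒nonZero; prime⇒irreducible;
  ¬prime[0]; ¬prime[1]; productOfPrimes≢0)
open import Data.Nat.Primality.Factorisation using (PrimeFactorisation; factorise)
open import Data.Nat.Tactic.RingSolver using () renaming (solve-∀ to solveℕ-∀)
open import Data.Product using (Σ; ∃; ∃₂; _×_; _,_; proj₁; proj₂)
open import Data.Sum using (_⊎_; inj₁; inj₂)
import Data.Vec.Functional as Vector
open import Data.Vec.Functional using (insertAt)
open import Data.Vec.Functional.Properties using (insertAt-lookup; insertAt-punchIn)
open import Function using (_∘_; it)
open import Level using (_⊔_)
open import Relation.Nullary using (¬_; yes; no)
open import Relation.Nullary.Decidable using (¬?; decidable-stable; dec⇒maybe)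
open import Relation.Binary.PropositionalEquality using (_≡_; _≢_; subst; subst₂; cong; cong₂)
import Relation.Binary.PropositionalEquality as ≡

open import Algebra.Properties.CommutativeMonoid.Sum ℤ.+-0-commutativeMonoid using ()
  renaming (sum to sumℤ; sum-remove to sumℤ-remove; sum-cong-≗ to sumℤ-cong-≗)
open import Algebra.Properties.CommutativeMonoid.Sum ℕ.+-0-commutativeMonoid using ()
  renaming (sum to sumℕ; sum-remove to sumℕ-remove)

-- Prime divisors, inverses modulo a prime, and a sieve.

prime∣! : ∀ {p} → Prime p → ∀ n → p ∣ n ! → p ℕ.≤ n
prime∣! pp zero p∣1 = ⊥-elim (¬prime[1] (subst Prime (∣1⇒≡1 p∣1) pp))
prime∣! pp (suc n) p∣ with euclidsLemma (suc n) (n !) pp p∣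
... | inj₁ p∣n = ∣⇒≤ p∣n
... | inj₂ p∣n! = ℕ.m≤n⇒m≤1+n (prime∣! pp n p∣n!)

-- In `(p C k) * (k ! * (p ∸ k) !) = p !` the right side is divisible by `p`, while both factorials
-- on the left have arguments below `p`.
prime∣C : ∀ {p k} → Prime p → 0 ℕ.< k → k ℕ.< p → p ∣ p C k
prime∣C {p@(suc _)} {k@(suc _)} pp 0<k k<p with euclidsLemma (p C k) (k ! ℕ.* (p ℕ.∸ k) !) pp p∣prod
  where
  instance _ = k ℕ.!* (p ℕ.∸ k) !≢0
  p∣prod : p ∣ (p C k) ℕ.* (k ! ℕ.* (p ℕ.∸ k) !)
  p∣prod = subst (p ∣_) (≡.sym (≡.trans
      (cong (ℕ._* (k ! ℕ.* (p ℕ.∸ k) !)) (nCk≡n!/k![n-k]! (ℕ.<⇒≤ k<p)))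
                                       (m/n*n≡m (k![n∸k]!∣n! (ℕ.<⇒≤ k<p)))))
                        (m∣m*n _)
... | inj₁ p∣C = p∣C
... | inj₂ p∣kk with euclidsLemma (k !) ((p ℕ.∸ k) !) pp p∣kk
...   | inj₁ p∣k! = ⊥-elim (ℕ.<⇒≱ k<p (prime∣! pp k p∣k!))
...   | inj₂ p∣k! = ⊥-elim (ℕ.<⇒≱ (ℕ.∸-monoʳ-< 0<k (ℕ.<⇒≤ k<p)) (prime∣! pp (p ℕ.∸ k) p∣k!))

prime∣prime : ∀ {p q} → Prime p → Prime q → p ∣ q → p ≡ q
prime∣prime pp pq p∣q with prime⇒irreducible pq p∣q
... | inj₁ ≡.refl = ⊥-elim (¬prime[1] pp)
... | inj₂ p≡q = p≡q

-- Bézout's identity over ℕ has two forms, according to which multiple is the larger. The first one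
-- is the claim; the second one yields the residue -1 and needs a change of sign.
inverse-mod : ∀ {p} → Prime p → ∀ n → ¬ p ∣ n → ∃₂ λ c a → c ℕ.* n ≡ 1 ℕ.+ a ℕ.* p
inverse-mod {0} pp = ⊥-elim (¬prime[0] pp)
inverse-mod {1} pp = ⊥-elim (¬prime[1] pp)
inverse-mod {p@(suc (suc p′))} pp n p∤n with coprime-Bézout {p} {n} coprime
  where
  coprime : Coprime p n
  coprime (d∣p , d∣n) with prime⇒irreducible pp d∣p
  ... | inj₁ d≡1 = d≡1
  ... | inj₂ ≡.refl = ⊥-elim (p∤n d∣n)
... | Bézout.-+ x y 1+xp≡yn = y , x , ≡.sym 1+xp≡yn
... | Bézout.+- (suc x) y 1+yn≡xp = suc p′ ℕ.* y , x ℕ.+ p′ ℕ.* suc x , ℕ.+-cancelʳ-≡ p _ _ negate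
  where
  open ≡.≡-Reasoning
  regroup : ∀ a b c → suc a ℕ.* b ℕ.* c ℕ.+ suc (suc a) ≡ 1 ℕ.+ suc a ℕ.* (1 ℕ.+ b ℕ.* c)
  regroup = solveℕ-∀
  expand : ∀ a b → 1 ℕ.+ suc a ℕ.* (suc b ℕ.* suc (suc a)) ≡
                   1 ℕ.+ (b ℕ.+ a ℕ.* suc b) ℕ.* suc (suc a) ℕ.+ suc (suc a)
  expand = solveℕ-∀
  -- Multiplying 1 + y n = x p by p - 1 turns the residue -1 of y n into 1.
  negate : suc p′ ℕ.* y ℕ.* n ℕ.+ p ≡ 1 ℕ.+ (x ℕ.+ p′ ℕ.* suc x) ℕ.* p ℕ.+ p
  negate = begin
    suc p′ ℕ.* y ℕ.* n ℕ.+ p                 ≡⟨ regroup p′ y n ⟩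
    1 ℕ.+ suc p′ ℕ.* (1 ℕ.+ y ℕ.* n)         ≡⟨ cong (λ z → 1 ℕ.+ suc p′ ℕ.* z) 1+yn≡xp ⟩
    1 ℕ.+ suc p′ ℕ.* (suc x ℕ.* p)           ≡⟨ expand p′ x ⟩
    1 ℕ.+ (x ℕ.+ p′ ℕ.* suc x) ℕ.* p ℕ.+ p   ∎

-- `P` is a product of multiples `c * r ≡ 1` modulo `p`, one for each positive `r ≤ B` prime to `p`.
-- So it absorbs every prime up to `B` other than `p` without leaving the class of 1.
sieve : ∀ {p} → Prime p → ∀ B → ∃₂ λ P a → P ≡ 1 ℕ.+ a ℕ.* p ×
        (∀ r → Prime r → r ℕ.≤ B → r ≢ p → r ∣ P)
sieve pp zero = 1 , 0 , ≡.refl , λ r pr r≤0 →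
    ⊥-elim (ℕ.<⇒≱ (ℕ.>-nonZero⁻¹ r {{prime⇒nonZero pr}}) r≤0)
sieve {p} pp (suc B) with sieve pp B | p ∣? suc B
... | P , a , P≡ , small | yes p∣ = P , a , P≡ , small′
  where
  small′ : ∀ r → Prime r → r ℕ.≤ suc B → r ≢ p → r ∣ P
  small′ r pr r≤ r≢p with ℕ.m≤n⇒m<n∨m≡n r≤
  ... | inj₁ (ℕ.s≤s r≤B) = small r pr r≤B r≢p
  ... | inj₂ ≡.refl = ⊥-elim (r≢p (≡.sym (prime∣prime pp pr p∣)))
... | P , a , P≡ , small | no p∤ with inverse-mod pp (suc B) p∤
...   | c , b , c≡ = P ℕ.* (c ℕ.* suc B) , a ℕ.+ b ℕ.+ a ℕ.* b ℕ.* p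
        , ≡.trans (cong₂ ℕ._*_ P≡ c≡) (expand a b p) , small′
  where
  expand : ∀ a b p → (1 ℕ.+ a ℕ.* p) ℕ.* (1 ℕ.+ b ℕ.* p) ≡ 1 ℕ.+ (a ℕ.+ b ℕ.+ a ℕ.* b ℕ.* p) ℕ.* p
  expand = solveℕ-∀
  small′ : ∀ r → Prime r → r ℕ.≤ suc B → r ≢ p → r ∣ P ℕ.* (c ℕ.* suc B)
  small′ r pr r≤ r≢p with ℕ.m≤n⇒m<n∨m≡n r≤
  ... | inj₁ (ℕ.s≤s r≤B) = ∣m⇒∣m*n _ (small r pr r≤B r≢p)
  ... | inj₂ ≡.refl = ∣n⇒∣m*n P (n∣m*n c)

-- The number is 1 + t u P with `P` from `sieve`. A prime q ≤ B divides t u P, through t if q = p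
-- and through P otherwise, so it cannot divide 1 + t u P. As P ≡ 1 modulo p, the class of 1 + t u
-- modulo p t is kept.
rough-progression : ∀ {p t} → Prime p → p ∣ t → ∀ B u → ∃ λ a →
  ∀ q → Prime q → q ∣ 1 ℕ.+ t ℕ.* (u ℕ.+ a ℕ.* p) → B ℕ.< q
rough-progression {p} {t} pp p∣t B u with sieve pp B
... | P , a , P≡ , small = a ℕ.* u , rough
  where
  regroup : ∀ u a p → (1 ℕ.+ a ℕ.* p) ℕ.* u ≡ u ℕ.+ a ℕ.* u ℕ.* p
  regroup = solveℕ-∀
  rough : ∀ q → Prime q → q ∣ 1 ℕ.+ t ℕ.* (u ℕ.+ a ℕ.* u ℕ.* p) → B ℕ.< q
  rough q pq q∣U with q ℕ.≤? B
  ... | no q≰B = ℕ.≰⇒> q≰B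
  ... | yes q≤B = ⊥-elim (¬prime[1]
      (subst Prime (∣1⇒≡1 (∣m+n∣m⇒∣n (subst (q ∣_) (ℕ.+-comm 1 _) q∣U) q∣rest)) pq))
    where
    q∣rest : q ∣ t ℕ.* (u ℕ.+ a ℕ.* u ℕ.* p)
    q∣rest with q ℕ.≟ p
    ... | yes ≡.refl = ∣m⇒∣m*n _ p∣t
    ... | no q≢p = ∣n⇒∣m*n t (subst (q ∣_) (≡.trans (cong (ℕ._* u) P≡) (regroup u a p))
        (∣m⇒∣m*n u (small q pq q≤B q≢p)))

-- The binomial theorem with a prime exponent.

module Freshman {c ℓ} (R : CommutativeSemiring c ℓ) where
  open CommutativeSemiring R
  open import Algebra.Properties.CommutativeSemiring.Exp R using (_^_)
  open import Algebra.Properties.Semiring.Mult semiring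
    using (×-congˡ; ×-assocˡ; ×-homo-1) renaming (_×_ to _·_)
  open import Algebra.Properties.Semiring.Sum semiring using (sum; sum-cong-≋; sum-init-last)
  import Algebra.Properties.CommutativeSemiring.Binomial R as Binomial
  open import Relation.Binary.Reasoning.Setoid setoid

  sum-× : ∀ n {m} (f : Fin m → Carrier) → sum (λ i → n · f i) ≈ n · sum f
  sum-× n {zero} f = sym (×-zero n)
    where
    ×-zero : ∀ n → n · 0# ≈ 0#
    ×-zero zero = refl
    ×-zero (suc n) = trans (+-identityˡ _) (×-zero n)
  sum-× n {suc m} f = trans (+-congˡ (sum-× n (f ∘ Fin.suc))) (sym (×-distrib-+ _ _ n))
    where
    open import Algebra.Properties.CommutativeMonoid.Mult +-commutativeMonoid using (×-distrib-+)

  -- The middle terms are kept as an explicit polynomial whose coefficients `d` do not depend on `x`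
  -- and `y`. Thus the cofactor of q is again an integer polynomial when `x` and `y` are.
  freshman : ∀ {q} → Prime q → ∃₂ λ m (d : Fin m → ℕ) → ∀ x y →
    (x + y) ^ q ≈ y ^ q + (q · sum (λ i → d i · (x ^ suc (toℕ i) * y ^ (q ℕ.∸ suc (toℕ i)))) + x ^
        q)
  freshman {suc m} pq = m , d , expand
    where
    q : ℕ
    q = suc m
    q∣C : ∀ i → q ∣ q C suc (toℕ i)
    q∣C i = prime∣C pq (ℕ.s≤s ℕ.z≤n) (ℕ.s≤s (toℕ<n i))
    d : Fin m → ℕ
    d i = quotient (q∣C i)
    d-eq : ∀ i → q C suc (toℕ i) ≡ q ℕ.* d i
    d-eq i = ≡.trans (m∣n⇒n≡quotient*m (q∣C i)) (ℕ.*-comm (d i) q)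
    expand : ∀ x y → (x + y) ^ q ≈
      y ^ q + (q · sum (λ i → d i · (x ^ suc (toℕ i) * y ^ (q ℕ.∸ suc (toℕ i)))) + x ^ q)
    expand x y = begin
      (x + y) ^ q ≈⟨ Binomial.theorem q x y ⟩
      term Fin.zero + sum (term ∘ Fin.suc) ≈⟨ +-congˡ (sum-init-last (term ∘ Fin.suc)) ⟩
      term Fin.zero + (sum (term ∘ Fin.suc ∘ inject₁) + term (Fin.suc (fromℕ m)))
        ≈⟨ +-cong (trans (×-homo-1 _) (*-identityˡ _))
            (+-cong (trans (sum-cong-≋ middle) (sum-× q {m} _)) last-term) ⟩
      y ^ q + (q · sum (λ i → d i · (x ^ suc (toℕ i) * y ^ (q ℕ.∸ suc (toℕ i)))) + x ^ q) ∎
      where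
      term : Fin (suc q) → Carrier
      term = Binomial.binomialTerm x y q
      middle : ∀ i → term (Fin.suc (inject₁ i)) ≈
          q · (d i · (x ^ suc (toℕ i) * y ^ (q ℕ.∸ suc (toℕ i))))
      middle i rewrite toℕ-inject₁ i = begin
        (q C suc (toℕ i)) · w ≈⟨ ×-congˡ {x = w} (d-eq i) ⟩
        (q ℕ.* d i) · w ≈⟨ sym (×-assocˡ w q (d i)) ⟩
        q · (d i · w) ∎
        where
        w : Carrier
        w = x ^ suc (toℕ i) * y ^ (q ℕ.∸ suc (toℕ i))
      last-term : term (Fin.suc (fromℕ m)) ≈ x ^ q
      last-term rewrite toℕ-fromℕ m | nCn≡1 q | ℕ.n∸n≡0 m = trans (×-homo-1 _) (*-identityʳ _)

-- Linear dependence of n + 1 vectors in ℤ^n.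

module LinearDependence where
  open import Data.Integer using (_+_; _*_; -_; _-_)

  -- Coordinate by coordinate, this turns a relation among the reduced vectors into one among the
  -- original vectors, in which the pivot has the coefficient -Σ c_i x_i.
  eliminate : ∀ {n} (a b : ℤ) (c x y : Fin n → ℤ) →
    - sumℤ (λ i → c i * x i) * b + sumℤ (λ i → a * c i * y i) ≡
        sumℤ (λ i → c i * (a * y i - x i * b))
  eliminate {zero} a b c x y = ≡.refl
  eliminate {suc n} a b c x y = ≡.trans
    (regroup a b (c Fin.zero) (x Fin.zero) (y Fin.zero)
        (sumℤ (λ i → c (Fin.suc i) * x (Fin.suc i))) _)
    (cong (λ z → c Fin.zero * (a * y Fin.zero - x Fin.zero * b) + z)
        (eliminate a b (c ∘ Fin.suc) (x ∘ Fin.suc) (y ∘ Fin.suc)))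
    where
    regroup : ∀ a b c x y s t → - (c * x + s) * b + (a * c * y + t) ≡
        c * (a * y - x * b) + (- s * b + t)
    regroup = solveℤ-∀

  sum-zero : ∀ {n} (f : Fin n → ℤ) → (∀ i → f i ≡ 0ℤ) → sumℤ f ≡ 0ℤ
  sum-zero {zero} f f≡0 = ≡.refl
  sum-zero {suc n} f f≡0 = cong₂ _+_ (f≡0 Fin.zero) (sum-zero (f ∘ Fin.suc) (f≡0 ∘ Fin.suc))

  -- Fraction-free Gaussian elimination on the first coordinate: if it vanishes throughout, one
  -- vector is dropped with coefficient 0; otherwise a pivot `p` with first coordinate `a ≢ 0`
  -- clears it from the other vectors.
  dependent : ∀ n (v : Fin (suc n) → Fin n → ℤ) → ∃ λ (c : Fin (suc n) → ℤ) →
    (∃ λ i → c i ≢ 0ℤ) × (∀ j → sumℤ (λ i → c i * v i j) ≡ 0ℤ)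
  dependent zero v = (λ _ → + 1) , (Fin.zero , λ ()) , λ ()
  dependent (suc n) v with any? (λ i → ¬? (v i Fin.zero ℤ.≟ 0ℤ))
  ... | no all-zero with dependent n (λ i j → v (Fin.suc i) (Fin.suc j))
  ...   | c , (i , ci≢0) , relation = 0ℤ Vector.∷ c , (Fin.suc i , ci≢0) , relation′
    where
    vanish : ∀ i → v i Fin.zero ≡ 0ℤ
    vanish i = decidable-stable (v i Fin.zero ℤ.≟ 0ℤ) (λ ≢0 → all-zero (i , ≢0))
    relation′ : ∀ j → sumℤ (λ i → (0ℤ Vector.∷ c) i * v i j) ≡ 0ℤ
    relation′ Fin.zero = sum-zero _ λ i →
        ≡.trans (cong ((0ℤ Vector.∷ c) i *_) (vanish i)) (ℤ.*-zeroʳ ((0ℤ Vector.∷ c) i))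
    relation′ (Fin.suc j) = ≡.trans (ℤ.+-identityˡ _) (relation j)
  dependent (suc n) v | yes (p , a≢0)
    with dependent n (λ i j → v p Fin.zero * v (punchIn p i)
        (Fin.suc j) - v (punchIn p i) Fin.zero * v p (Fin.suc j))
  ...   | c , (i , ci≢0) , relation = c′ , (punchIn p i , nonzero) , relation′
    where
    a = v p Fin.zero
    x : Fin (suc n) → ℤ
    x i = v (punchIn p i) Fin.zero
    c′ : Fin (suc (suc n)) → ℤ
    c′ = insertAt (λ i → a * c i) p (- sumℤ (λ i → c i * x i))
    nonzero : c′ (punchIn p i) ≢ 0ℤ
    nonzero eq with ℤ.i*j≡0⇒i≡0∨j≡0 a
        (≡.trans (≡.sym (insertAt-punchIn (λ i → a * c i) p (- sumℤ (λ i → c i * x i)) i)) eq)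
    ... | inj₁ a≡0 = a≢0 a≡0
    ... | inj₂ ci≡0 = ci≢0 ci≡0
    reduced : ∀ j → sumℤ (λ i → c i * (a * v (punchIn p i) j - x i * v p j)) ≡ 0ℤ
    reduced Fin.zero = sum-zero _ λ i → cancel (c i) a (x i)
      where
      cancel : ∀ c a x → c * (a * x - x * a) ≡ 0ℤ
      cancel = solveℤ-∀
    reduced (Fin.suc j) = relation j
    relation′ : ∀ j → sumℤ (λ i → c′ i * v i j) ≡ 0ℤ
    relation′ j = begin
      sumℤ (λ i → c′ i * v i j) ≡⟨ sumℤ-remove {i = p} (λ i → c′ i * v i j) ⟩
      c′ p * v p j + sumℤ (λ i → c′ (punchIn p i) * v (punchIn p i) j)
        ≡⟨ cong₂ _+_ (cong (_* v p j) (insertAt-lookup (λ i → a * c i) p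
            (- sumℤ (λ i → c i * x i))))
                     (sumℤ-cong-≗ (λ i → cong (_* v (punchIn p i) j)
                         (insertAt-punchIn (λ i → a * c i) p (- sumℤ (λ i → c i * x i)) i))) ⟩
      - sumℤ (λ i → c i * x i) * v p j + sumℤ (λ i → a * c i * v (punchIn p i) j)
        ≡⟨ eliminate a (v p j) c x (λ i → v (punchIn p i) j) ⟩
      sumℤ (λ i → c i * (a * v (punchIn p i) j - x i * v p j)) ≡⟨ reduced j ⟩
      0ℤ ∎
      where open ≡.≡-Reasoning

-- The ring homomorphism from ℤ to R.

module Integers {c ℓ} (R : CommutativeRing c ℓ) where
  open CommutativeRing R
  open import Algebra.Properties.Semiring.Mult semiring
    using (×-homo-+; ×1-homo-*) renaming (_×_ to _·_)
  open import Algebra.Properties.Ring ring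
    using (-‿distribˡ-*; -‿distribʳ-*; -‿involutive; -0#≈0#; -‿+-comm)
  open import Relation.Binary.Reasoning.Setoid setoid

  ι : ℤ → Carrier
  ι (+ n) = n · 1#
  ι -[1+ n ] = - (suc n · 1#)

  ι-neg : ∀ i → ι (ℤ.- i) ≈ - ι i
  ι-neg (+ zero) = sym -0#≈0#
  ι-neg (+ suc n) = refl
  ι-neg -[1+ n ] = sym (-‿involutive _)

  ι-⊖ : ∀ m n → ι (m ⊖ n) ≈ m · 1# - n · 1#
  ι-⊖ zero zero = sym (-‿inverseʳ 0#)
  ι-⊖ zero (suc n) = sym (+-identityˡ _)
  ι-⊖ (suc m) zero = sym (trans (+-congˡ -0#≈0#) (+-identityʳ _))
  ι-⊖ (suc m) (suc n) = begin
    ι (suc m ⊖ suc n) ≡⟨ cong ι (ℤ.[1+m]⊖[1+n]≡m⊖n m n) ⟩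
    ι (m ⊖ n) ≈⟨ ι-⊖ m n ⟩
    m · 1# - n · 1# ≈⟨ +-congˡ (sym (+-identityˡ _)) ⟩
    m · 1# + (0# + - (n · 1#)) ≈⟨ +-congˡ (+-congʳ (sym (-‿inverseʳ 1#))) ⟩
    m · 1# + ((1# - 1#) + - (n · 1#)) ≈⟨ +-congˡ (+-assoc _ _ _) ⟩
    m · 1# + (1# + (- 1# + - (n · 1#))) ≈⟨ sym (+-assoc _ _ _) ⟩
    (m · 1# + 1#) + (- 1# + - (n · 1#)) ≈⟨ +-cong (+-comm _ _) (-‿+-comm _ _) ⟩
    suc m · 1# - suc n · 1# ∎

  ι-+ : ∀ i j → ι (i ℤ.+ j) ≈ ι i + ι j
  ι-+ (+ m) (+ n) = ×-homo-+ 1# m n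
  ι-+ (+ m) -[1+ n ] = ι-⊖ m (suc n)
  ι-+ -[1+ m ] (+ n) = trans (ι-⊖ n (suc m)) (+-comm _ _)
  ι-+ -[1+ m ] -[1+ n ] = begin
    - (suc (suc (m ℕ.+ n)) · 1#) ≡⟨ cong (λ z → - (suc z · 1#)) (≡.sym (ℕ.+-suc m n)) ⟩
    - ((suc m ℕ.+ suc n) · 1#) ≈⟨ -‿cong (×-homo-+ 1# (suc m) (suc n)) ⟩
    - (suc m · 1# + suc n · 1#) ≈⟨ sym (-‿+-comm _ _) ⟩
    - (suc m · 1#) + - (suc n · 1#) ∎

  ι-*-pos : ∀ m n → ι (+ m ℤ.* + n) ≈ ι (+ m) * ι (+ n)
  ι-*-pos m n = trans (reflexive (cong ι (≡.sym (ℤ.pos-* m n)))) (×1-homo-* m n)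

  ι-*-posˡ : ∀ m j → ι (+ m ℤ.* j) ≈ ι (+ m) * ι j
  ι-*-posˡ m (+ n) = ι-*-pos m n
  ι-*-posˡ m j@(-[1+ n ]) = begin
    ι (+ m ℤ.* ℤ.- (+ suc n)) ≡⟨ cong ι (≡.sym (ℤ.neg-distribʳ-* (+ m) (+ suc n))) ⟩
    ι (ℤ.- (+ m ℤ.* + suc n)) ≈⟨ ι-neg (+ m ℤ.* + suc n) ⟩
    - ι (+ m ℤ.* + suc n) ≈⟨ -‿cong (ι-*-pos m (suc n)) ⟩
    - (ι (+ m) * ι (+ suc n)) ≈⟨ -‿distribʳ-* _ _ ⟩
    ι (+ m) * ι j ∎

  ι-* : ∀ i j → ι (i ℤ.* j) ≈ ι i * ι j
  ι-* (+ m) j = ι-*-posˡ m j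
  ι-* i@(-[1+ m ]) j = begin
    ι (ℤ.- (+ suc m) ℤ.* j) ≡⟨ cong ι (≡.sym (ℤ.neg-distribˡ-* (+ suc m) j)) ⟩
    ι (ℤ.- (+ suc m ℤ.* j)) ≈⟨ ι-neg (+ suc m ℤ.* j) ⟩
    - ι (+ suc m ℤ.* j) ≈⟨ -‿cong (ι-*-posˡ (suc m) j) ⟩
    - (ι (+ suc m) * ι j) ≈⟨ -‿distribˡ-* _ _ ⟩
    ι i * ι j ∎

  natR≡× : ∀ n → natR R n ≡ n · 1#
  natR≡× zero = ≡.refl
  natR≡× (suc n) = cong (λ z → 1# + z) (natR≡× n)

  ι-≈0 : CharZeroDomain R → ∀ i → ι i ≈ 0# → i ≡ 0ℤ
  ι-≈0 dom (+ zero) _ = ≡.refl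
  ι-≈0 dom (+ suc n) eq = ⊥-elim (charZero n (trans (reflexive (natR≡× (suc n))) eq))
    where open CharZeroDomain dom
  ι-≈0 dom -[1+ n ] eq = ⊥-elim (charZero n (begin
    natR R (suc n) ≡⟨ natR≡× (suc n) ⟩
    suc n · 1# ≈⟨ sym (-‿involutive _) ⟩
    - - (suc n · 1#) ≈⟨ -‿cong eq ⟩
    - 0# ≈⟨ -0#≈0# ⟩
    0# ∎))
    where open CharZeroDomain dom

-- Cancellation and powers of roots of unity in a domain of characteristic zero.

module Domain {c ℓ} (R : CommutativeRing c ℓ) (dom : CharZeroDomain R) where
  open CommutativeRing R
  open CharZeroDomain dom
  open Integers R
  open import Algebra.Properties.CommutativeSemiring.Exp commutativeSemiring
  open import Algebra.Properties.Semiring.Sum semiring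
    using (sum; sum-cong-≋; sum-remove; sum-replicate-zero; *-distribˡ-sum)
  open import Algebra.Properties.Ring ring using (x[y-z]≈xy-xz; x∙y⁻¹≈ε⇒x≈y; +-cancelˡ)
  open import Relation.Binary.Reasoning.Setoid setoid

  *-cancelˡ : ∀ {x y z} → x * y ≈ x * z → x ≈ 0# ⊎ y ≈ z
  *-cancelˡ {x} {y} {z} eq with noZeroDivs x (y - z) (begin
    x * (y - z) ≈⟨ x[y-z]≈xy-xz x y z ⟩
    x * y - x * z ≈⟨ +-congʳ eq ⟩
    x * z - x * z ≈⟨ -‿inverseʳ _ ⟩
    0# ∎)
  ... | inj₁ x≈0 = inj₁ x≈0
  ... | inj₂ y-z≈0 = inj₂ (x∙y⁻¹≈ε⇒x≈y y z y-z≈0)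

  ι-cancel : ∀ {i x} → i ≢ 0ℤ → ι i * x ≈ 0# → x ≈ 0#
  ι-cancel {i} {x} i≢0 eq with noZeroDivs (ι i) x eq
  ... | inj₁ ιi≈0 = ⊥-elim (i≢0 (ι-≈0 dom i ιi≈0))
  ... | inj₂ x≈0 = x≈0

  sum-zero : ∀ {n} (f : Fin n → Carrier) → (∀ i → f i ≈ 0#) → sum f ≈ 0#
  sum-zero {n} f f≈0 = trans (sum-cong-≋ f≈0) (sum-replicate-zero n)

  sum-single : ∀ {n} (f : Fin n → Carrier) j → (∀ i → i ≢ j → f i ≈ 0#) → sum f ≈ f j
  sum-single {suc n} f j off = begin
    sum f ≈⟨ sum-remove {i = j} f ⟩
    f j + sum (f ∘ punchIn j) ≈⟨ +-congˡ (sum-zero (f ∘ punchIn j) (λ i → off _ (punchInᵢ≢i j i))) ⟩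
    f j + 0# ≈⟨ +-identityʳ _ ⟩
    f j ∎

  1^n≈1 : ∀ n → 1# ^ n ≈ 1#
  1^n≈1 zero = refl
  1^n≈1 (suc n) = trans (*-identityˡ _) (1^n≈1 n)

  ^-swap : ∀ x m n → (x ^ m) ^ n ≈ (x ^ n) ^ m
  ^-swap x m n = trans (^-assocʳ x m n) (trans (^-congʳ x (ℕ.*-comm m n)) (sym (^-assocʳ x n m)))

  root-^ : ∀ x k → x ^ k ≈ 1# → ∀ n → (x ^ n) ^ k ≈ 1#
  root-^ x k root n = trans (^-swap x n k) (trans (^-congˡ n root) (1^n≈1 n))

  ^-% : ∀ x k .{{_ : NonZero k}} → x ^ k ≈ 1# → ∀ n → x ^ (n % k) ≈ x ^ n
  ^-% x k root n = sym (begin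
    x ^ n ≈⟨ ^-congʳ x (m≡m%n+[m/n]*n n k) ⟩
    x ^ (n % k ℕ.+ n / k ℕ.* k) ≈⟨ ^-homo-* x (n % k) (n / k ℕ.* k) ⟩
    x ^ (n % k) * x ^ (n / k ℕ.* k)
      ≈⟨ *-congˡ (trans (sym (^-assocʳ x (n / k) k)) (root-^ x k root (n / k))) ⟩
    x ^ (n % k) * 1# ≈⟨ *-identityʳ _ ⟩
    x ^ (n % k) ∎)

  ^-cong-% : ∀ x k .{{_ : NonZero k}} → x ^ k ≈ 1# → ∀ m n → m % k ≡ n % k → x ^ m ≈ x ^ n
  ^-cong-% x k root m n eq = trans (sym (^-% x k root m)) (trans (^-congʳ x eq) (^-% x k root n))

  pow≡^ : ∀ x n → pow R x n ≡ x ^ n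
  pow≡^ x zero = ≡.refl
  pow≡^ x (suc n) = cong (λ z → x * z) (pow≡^ x n)

  -- The formula (x - 1)(1 + x + ... + x^(n-1)) = x^n - 1, rearranged so as to avoid subtraction.
  geometric : ∀ x n → 1# + x * sum {n} (λ v → x ^ toℕ v) ≈ sum {n} (λ v → x ^ toℕ v) + x ^ n
  geometric x zero = trans (+-congˡ (zeroʳ x)) (+-comm _ _)
  geometric x (suc n) = begin
    1# + x * S′ ≈⟨ +-congˡ (*-congˡ S′≈) ⟩
    1# + x * (1# + x * S) ≈⟨ +-congˡ (*-congˡ (geometric x n)) ⟩
    1# + x * (S + x ^ n) ≈⟨ +-congˡ (distribˡ x S (x ^ n)) ⟩
    1# + (x * S + x ^ suc n) ≈⟨ sym (+-assoc _ _ _) ⟩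
    (1# + x * S) + x ^ suc n ≈⟨ +-congʳ (sym S′≈) ⟩
    S′ + x ^ suc n ∎
    where
    S = sum {n} (λ v → x ^ toℕ v)
    S′ = sum {suc n} (λ v → x ^ toℕ v)
    S′≈ : S′ ≈ 1# + x * S
    S′≈ = +-congˡ (sym (*-distribˡ-sum {n} x (λ v → x ^ toℕ v)))

  -- By `geometric` the sum S satisfies S x = S, and cancelling a nonzero S would give x = 1.
  sum-powers≈0 : ∀ x n → x ^ n ≈ 1# → ¬ (x ≈ 1#) → sum {n} (λ v → x ^ toℕ v) ≈ 0#
  sum-powers≈0 x n root x≉1 with *-cancelˡ {S} {x} {1#} (+-cancelˡ 1# (S * x) (S * 1#) (begin
    1# + S * x ≈⟨ +-congˡ (*-comm S x) ⟩
    1# + x * S ≈⟨ geometric x n ⟩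
    S + x ^ n ≈⟨ +-cong (sym (*-identityʳ S)) root ⟩
    S * 1# + 1# ≈⟨ +-comm _ _ ⟩
    1# + S * 1# ∎))
    where S = sum {n} (λ v → x ^ toℕ v)
  ... | inj₁ S≈0 = S≈0
  ... | inj₂ x≈1 = ⊥-elim (x≉1 x≈1)

-- Integer polynomials as functions on the k-th roots of unity.

module Combinations {c ℓ} (R : CommutativeRing c ℓ) (dom : CharZeroDomain R)
  (k : ℕ) .{{_ : NonZero k}} (ζ : CommutativeRing.Carrier R) (prim : IsPrimitiveRoot R k ζ) where
  open CommutativeRing R
  open IsPrimitiveRoot prim using (isPrimitive)
  open Integers R
  open Domain R dom
  open import Algebra.Properties.CommutativeSemiring.Exp commutativeSemiring
  open import Algebra.Properties.Semiring.Mult semiring using () renaming (_×_ to _·_)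
  open import Algebra.Properties.Semiring.Sum semiring
    using (sum; sum-cong-≋; ∑-distrib-+; ∑-comm; *-distribˡ-sum; *-distribʳ-sum; sum-replicate)
  open import Algebra.Properties.CommutativeSemigroup *-commutativeSemigroup
    using () renaming (x∙yz≈y∙xz to x*yz≈y*xz)
  open import Algebra.Properties.Ring ring using (-‿distribˡ-*)
  open import Relation.Binary.Reasoning.Setoid setoid

  ζ^k≈1 : ζ ^ k ≈ 1#
  ζ^k≈1 = trans (reflexive (≡.sym (pow≡^ ζ k))) (IsPrimitiveRoot.root prim)

  -- Dividing by ζ^a, whose inverse is ζ^(k-a), gives ζ^(b-a) = 1 with b - a < k, which primitivity
  -- allows only for b = a.
  ζ^-injective-≤ : ∀ {a b} → a ℕ.≤ b → b ℕ.< k → ζ ^ a ≈ ζ ^ b → a ≡ b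
  ζ^-injective-≤ {a} {b} a≤b b<k eq with b ℕ.∸ a ℕ.≟ 0
  ... | yes b∸a≡0 = ℕ.≤-antisym a≤b (ℕ.m∸n≡0⇒m≤n b∸a≡0)
  ... | no b∸a≢0 = ⊥-elim (isPrimitive (b ℕ.∸ a) (ℕ.n≢0⇒n>0 b∸a≢0) (ℕ.≤-<-trans (ℕ.m∸n≤m b a) b<k)
                           (trans (reflexive (pow≡^ ζ (b ℕ.∸ a))) one))
    where
    inv : ζ ^ (k ℕ.∸ a) * ζ ^ a ≈ 1#
    inv = trans (sym (^-homo-* ζ (k ℕ.∸ a) a))
                (trans (^-congʳ ζ (ℕ.m∸n+n≡m (ℕ.≤-trans a≤b (ℕ.<⇒≤ b<k)))) ζ^k≈1)
    one : ζ ^ (b ℕ.∸ a) ≈ 1#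
    one = begin
      ζ ^ (b ℕ.∸ a) ≈⟨ sym (*-identityˡ _) ⟩
      1# * ζ ^ (b ℕ.∸ a) ≈⟨ *-congʳ (sym inv) ⟩
      (ζ ^ (k ℕ.∸ a) * ζ ^ a) * ζ ^ (b ℕ.∸ a) ≈⟨ *-assoc _ _ _ ⟩
      ζ ^ (k ℕ.∸ a) * (ζ ^ a * ζ ^ (b ℕ.∸ a)) ≈⟨ *-congˡ (sym (^-homo-* ζ a (b ℕ.∸ a))) ⟩
      ζ ^ (k ℕ.∸ a) * ζ ^ (a ℕ.+ (b ℕ.∸ a)) ≈⟨ *-congˡ (^-congʳ ζ (ℕ.m+[n∸m]≡n a≤b)) ⟩
      ζ ^ (k ℕ.∸ a) * ζ ^ b ≈⟨ *-congˡ (sym eq) ⟩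
      ζ ^ (k ℕ.∸ a) * ζ ^ a ≈⟨ inv ⟩
      1# ∎

  ζ^-injective : ∀ a b → ζ ^ a ≈ ζ ^ b → a % k ≡ b % k
  ζ^-injective a b eq with ℕ.≤-total (a % k) (b % k)
  ... | inj₁ ≤ = ζ^-injective-≤ ≤ (m%n<n b k)
      (trans (^-% ζ k ζ^k≈1 a) (trans eq (sym (^-% ζ k ζ^k≈1 b))))
  ... | inj₂ ≥ = ≡.sym (ζ^-injective-≤ ≥ (m%n<n a k)
      (trans (^-% ζ k ζ^k≈1 b) (trans (sym eq) (sym (^-% ζ k ζ^k≈1 a)))))

  expand : (Fin k → ℤ) → ℕ → Carrier
  expand c v = sum (λ i → ι (c i) * (ζ ^ v) ^ toℕ i)

  -- Dilating the argument `v` by `s` amounts to substituting x^s for x.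
  χ-dilate : ∀ s v i → (ζ ^ (s ℕ.* v)) ^ i ≈ (ζ ^ v) ^ (s ℕ.* i)
  χ-dilate s v i = begin
    (ζ ^ (s ℕ.* v)) ^ i ≈⟨ ^-congˡ i (^-congʳ ζ (ℕ.*-comm s v)) ⟩
    (ζ ^ (v ℕ.* s)) ^ i ≈⟨ ^-congˡ i (sym (^-assocʳ ζ v s)) ⟩
    ((ζ ^ v) ^ s) ^ i ≈⟨ ^-assocʳ (ζ ^ v) s i ⟩
    (ζ ^ v) ^ (s ℕ.* i) ∎

  -- The values at all k-th roots of unity ζ ^ v of an integer polynomial: a
  -- concrete form of the group ring ℤ[x]/(x^k - 1), with pointwise operations.
  Comb : (ℕ → Carrier) → Set ℓ
  Comb ψ = Σ (Fin k → ℤ) λ c → ∀ v → ψ v ≈ expand c v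

  expand-+ : ∀ c d v → expand c v + expand d v ≈ expand (λ i → c i ℤ.+ d i) v
  expand-+ c d v = begin
    expand c v + expand d v
      ≈⟨ sym (∑-distrib-+ {k} (λ i → ι (c i) * (ζ ^ v) ^ toℕ i) (λ i → ι (d i) * (ζ ^ v) ^ toℕ i)) ⟩
    sum (λ i → ι (c i) * (ζ ^ v) ^ toℕ i + ι (d i) * (ζ ^ v) ^ toℕ i)
      ≈⟨ sum-cong-≋ {k} (λ i → trans (sym (distribʳ ((ζ ^ v) ^ toℕ i) (ι (c i)) (ι (d i))))
          (*-congʳ (sym (ι-+ (c i) (d i))))) ⟩
    expand (λ i → c i ℤ.+ d i) v ∎

  expand-scale : ∀ a c v → ι a * expand c v ≈ expand (λ i → a ℤ.* c i) v
  expand-scale a c v = begin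
    ι a * expand c v ≈⟨ *-distribˡ-sum {k} (ι a) (λ i → ι (c i) * (ζ ^ v) ^ toℕ i) ⟩
    sum (λ i → ι a * (ι (c i) * (ζ ^ v) ^ toℕ i))
      ≈⟨ sum-cong-≋ {k} (λ i → trans (sym (*-assoc (ι a) (ι (c i)) ((ζ ^ v) ^ toℕ i)))
          (*-congʳ (sym (ι-* a (c i))))) ⟩
    expand (λ i → a ℤ.* c i) v ∎

  abstract
    comb-resp : ∀ {ψ φ} → (∀ v → ψ v ≈ φ v) → Comb φ → Comb ψ
    comb-resp ψ≈φ (c , φ≈) = c , λ v → trans (ψ≈φ v) (φ≈ v)

    comb-+ : ∀ {ψ φ} → Comb ψ → Comb φ → Comb (λ v → ψ v + φ v)
    comb-+ (c , ψ≈) (d , φ≈) = (λ i → c i ℤ.+ d i) , λ v →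
        trans (+-cong (ψ≈ v) (φ≈ v)) (expand-+ c d v)

    comb-scale : ∀ {ψ} a → Comb ψ → Comb (λ v → ι a * ψ v)
    comb-scale a (c , ψ≈) = (λ i → a ℤ.* c i) , λ v → trans (*-congˡ (ψ≈ v)) (expand-scale a c v)

    comb-0 : Comb (λ _ → 0#)
    comb-0 = (λ _ → 0ℤ) , λ v → sym (sum-zero {k} _ (λ i → zeroˡ ((ζ ^ v) ^ toℕ i)))

    comb-sum : ∀ {n} {ψ : Fin n → ℕ → Carrier} → (∀ i → Comb (ψ i)) → Comb (λ v → sum (λ i → ψ i v))
    comb-sum {zero} combs = comb-0
    comb-sum {suc n} combs = comb-+ (combs Fin.zero) (comb-sum (combs ∘ Fin.suc))

    indicator : Fin k → Fin k → ℤ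
    indicator j i with i ≟ᶠ j
    ... | yes _ = + 1
    ... | no _ = 0ℤ

    indicator-≡ : ∀ j → indicator j j ≡ + 1
    indicator-≡ j with j ≟ᶠ j
    ... | yes _ = ≡.refl
    ... | no j≢j = ⊥-elim (j≢j ≡.refl)

    indicator-≢ : ∀ j i → i ≢ j → indicator j i ≡ 0ℤ
    indicator-≢ j i i≢j with i ≟ᶠ j
    ... | yes i≡j = ⊥-elim (i≢j i≡j)
    ... | no _ = ≡.refl

    -- All arguments ζ^v are k-th roots of unity, so the exponent can be reduced modulo k and a unit
    -- coefficient vector suffices.
    comb-χ : ∀ n → Comb (λ v → (ζ ^ v) ^ n)
    comb-χ n = indicator j , λ v → sym (begin
      expand (indicator j) v
        ≈⟨ sum-single {k} (λ i → ι (indicator j i) * (ζ ^ v) ^ toℕ i) j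
            (λ i i≢j → trans (*-congʳ (reflexive (cong ι (indicator-≢ j i i≢j)))) (zeroˡ _)) ⟩
      ι (indicator j j) * (ζ ^ v) ^ toℕ j ≈⟨ *-congʳ (reflexive (cong ι (indicator-≡ j))) ⟩
      ι (+ 1) * (ζ ^ v) ^ toℕ j ≈⟨ trans (*-congʳ (+-identityʳ 1#)) (*-identityˡ _) ⟩
      (ζ ^ v) ^ toℕ j ≈⟨ ^-congʳ (ζ ^ v) (toℕ-fromℕ< (m%n<n n k)) ⟩
      (ζ ^ v) ^ (n % k) ≈⟨ ^-% (ζ ^ v) k (root-^ ζ k ζ^k≈1 v) n ⟩
      (ζ ^ v) ^ n ∎)
      where
      j : Fin k
      j = fromℕ< (m%n<n n k)

    comb-* : ∀ {ψ φ} → Comb ψ → Comb φ → Comb (λ v → ψ v * φ v)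
    comb-* {ψ} {φ} (c , ψ≈) (d , φ≈) = comb-resp product-expansion
      (comb-sum λ i → comb-scale (c i) (comb-sum λ j → comb-scale (d j) (comb-χ (toℕ i ℕ.+ toℕ j))))
      where
      product-expansion : ∀ v → ψ v * φ v ≈
        sum (λ i → ι (c i) * sum (λ j → ι (d j) * (ζ ^ v) ^ (toℕ i ℕ.+ toℕ j)))
      product-expansion v = begin
        ψ v * φ v ≈⟨ *-cong (ψ≈ v) (φ≈ v) ⟩
        expand c v * expand d v ≈⟨ *-distribʳ-sum {k} (expand d v) (λ i → ι (c i) * x ^ toℕ i) ⟩
        sum (λ i → ι (c i) * x ^ toℕ i * expand d v)
          ≈⟨ sum-cong-≋ {k} (λ i → trans (*-assoc (ι (c i)) (x ^ toℕ i) (expand d v))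
              (*-congˡ (shift i))) ⟩
        sum (λ i → ι (c i) * sum (λ j → ι (d j) * x ^ (toℕ i ℕ.+ toℕ j))) ∎
        where
        x : Carrier
        x = ζ ^ v
        shift : ∀ i → x ^ toℕ {k} i * expand d v ≈ sum (λ j → ι (d j) * x ^ (toℕ i ℕ.+ toℕ j))
        shift i = trans (*-distribˡ-sum {k} (x ^ toℕ i) (λ j → ι (d j) * x ^ toℕ j))
          (sum-cong-≋ {k} (λ j → trans (x*yz≈y*xz (x ^ toℕ i) (ι (d j)) (x ^ toℕ j))
              (*-congˡ (sym (^-homo-* x (toℕ i) (toℕ j))))))

    comb-1 : Comb (λ _ → 1#)
    comb-1 = comb-χ 0

    comb-^ : ∀ {ψ} n → Comb ψ → Comb (λ v → ψ v ^ n)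
    comb-^ zero _ = comb-1
    comb-^ (suc n) comb = comb-* comb (comb-^ n comb)

    comb-· : ∀ {ψ} n → Comb ψ → Comb (λ v → n · ψ v)
    comb-· zero _ = comb-0
    comb-· (suc n) comb = comb-+ comb (comb-· n comb)

    comb-neg : ∀ {ψ} → Comb ψ → Comb (λ v → - ψ v)
    comb-neg {ψ} comb = comb-resp (λ v → sym (begin
      ι -[1+ 0 ] * ψ v ≈⟨ *-congʳ (-‿cong (+-identityʳ 1#)) ⟩
      - 1# * ψ v ≈⟨ sym (-‿distribˡ-* 1# (ψ v)) ⟩
      - (1# * ψ v) ≈⟨ -‿cong (*-identityˡ (ψ v)) ⟩
      - ψ v ∎)) (comb-scale -[1+ 0 ] comb)

    comb-dilate : ∀ {ψ} s → Comb ψ → Comb (λ v → ψ (s ℕ.* v))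
    comb-dilate {ψ} s (c , ψ≈) = comb-resp
      (λ v → trans (ψ≈ (s ℕ.* v)) (sum-cong-≋ {k} (λ i → *-congˡ (χ-dilate s v (toℕ i)))))
      (comb-sum λ i → comb-scale (c i) (comb-χ (s ℕ.* toℕ i)))

    comb-cong-% : ∀ {ψ} → Comb ψ → ∀ u v → u % k ≡ v % k → ψ u ≈ ψ v
    comb-cong-% {ψ} (c , ψ≈) u v eq = trans (ψ≈ u)
      (trans (sum-cong-≋ {k} (λ i → *-congˡ (^-congˡ (toℕ i) (^-cong-% ζ k ζ^k≈1 u v eq))))
          (sym (ψ≈ v)))

    -- Discrete Fourier inversion: multiplying by ζ^(-jv) and summing over all residues v leaves k
    -- times the coefficient `c j`. The values at all ζ^v are needed, since distinct coefficient
    -- vectors can agree at ζ alone.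
    expand-injective : ∀ c → (∀ v → expand c v ≈ 0#) → ∀ j → c j ≡ 0ℤ
    expand-injective c vanish j = ι-≈0 dom (c j)
        (ι-cancel {+ k} (λ eq → ℕ.≢-nonZero⁻¹ k (ℤ.+-injective eq)) k*cj≈0)
      where
      -- ζ^s is the inverse of ζ^j, so the terms of `column j` are all 1.
      s : ℕ
      s = k ℕ.∸ toℕ j
      column : Fin k → Carrier
      column i = sum {k} (λ v → (ζ ^ (s ℕ.+ toℕ i)) ^ toℕ v)
      ζ^[s+j]≈1 : ζ ^ (s ℕ.+ toℕ j) ≈ 1#
      ζ^[s+j]≈1 = trans (^-congʳ ζ (ℕ.m∸n+n≡m (ℕ.<⇒≤ (toℕ<n j)))) ζ^k≈1
      column-j : column j ≈ ι (+ k)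
      column-j = trans (sum-cong-≋ {k} (λ v → trans (^-congˡ (toℕ v) ζ^[s+j]≈1) (1^n≈1 (toℕ v))))
          (sum-replicate k)
      off-diagonal : ∀ i → i ≢ j → ¬ (ζ ^ (s ℕ.+ toℕ i) ≈ 1#)
      off-diagonal i i≢j eq = i≢j (toℕ-injective (≡.trans (≡.sym (m<n⇒m%n≡m (toℕ<n i)))
        (≡.trans (ζ^-injective (toℕ i) (toℕ j) (begin
          ζ ^ toℕ i ≈⟨ sym (*-identityʳ _) ⟩
          ζ ^ toℕ i * 1# ≈⟨ *-congˡ (sym ζ^[s+j]≈1) ⟩
          ζ ^ toℕ i * ζ ^ (s ℕ.+ toℕ j) ≈⟨ *-congˡ (^-homo-* ζ s (toℕ j)) ⟩
          ζ ^ toℕ i * (ζ ^ s * ζ ^ toℕ j) ≈⟨ sym (*-assoc _ _ _) ⟩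
          (ζ ^ toℕ i * ζ ^ s) * ζ ^ toℕ j
            ≈⟨ *-congʳ (trans (*-comm _ _) (trans (sym (^-homo-* ζ s (toℕ i))) eq)) ⟩
          1# * ζ ^ toℕ j ≈⟨ *-identityˡ _ ⟩
          ζ ^ toℕ j ∎)) (m<n⇒m%n≡m (toℕ<n j)))))
      term : ∀ v i → (ζ ^ v) ^ s * (ι (c i) * (ζ ^ v) ^ toℕ i) ≈ ι (c i) * (ζ ^ (s ℕ.+ toℕ i)) ^ v
      term v i = trans (x*yz≈y*xz ((ζ ^ v) ^ s) (ι (c i)) ((ζ ^ v) ^ toℕ i))
        (*-congˡ (trans (sym (^-homo-* (ζ ^ v) s (toℕ i))) (^-swap ζ v (s ℕ.+ toℕ i))))
      k*cj≈0 : ι (+ k) * ι (c j) ≈ 0#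
      k*cj≈0 = begin
        ι (+ k) * ι (c j) ≈⟨ trans (*-comm _ _) (*-congˡ (sym column-j)) ⟩
        ι (c j) * column j ≈⟨ sym (sum-single {k} (λ i → ι (c i) * column i) j (λ i i≢j →
          trans (*-congˡ (sum-powers≈0 _ k (root-^ ζ k ζ^k≈1 (s ℕ.+ toℕ i)) (off-diagonal i i≢j)))
              (zeroʳ _))) ⟩
        sum {k} (λ i → ι (c i) * column i)
          ≈⟨ sum-cong-≋ {k} (λ i → *-distribˡ-sum {k} (ι (c i))
              (λ v → (ζ ^ (s ℕ.+ toℕ i)) ^ toℕ v)) ⟩
        sum {k} (λ i → sum {k} (λ v → ι (c i) * (ζ ^ (s ℕ.+ toℕ i)) ^ toℕ v))
          ≈⟨ ∑-comm {k} {k} (λ i v → ι (c i) * (ζ ^ (s ℕ.+ toℕ i)) ^ toℕ v) ⟩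
        sum {k} (λ v → sum {k} (λ i → ι (c i) * (ζ ^ (s ℕ.+ toℕ i)) ^ toℕ v))
          ≈⟨ sum-zero {k} _ (λ v → begin
          sum {k} (λ i → ι (c i) * (ζ ^ (s ℕ.+ toℕ i)) ^ toℕ v)
            ≈⟨ sum-cong-≋ {k} (λ i → sym (term (toℕ v) i)) ⟩
          sum {k} (λ i → (ζ ^ toℕ v) ^ s * (ι (c i) * (ζ ^ toℕ v) ^ toℕ i))
            ≈⟨ sym (*-distribˡ-sum {k} ((ζ ^ toℕ v) ^ s) (λ i → ι (c i) * (ζ ^ toℕ v) ^ toℕ i)) ⟩
          (ζ ^ toℕ v) ^ s * expand c (toℕ v) ≈⟨ *-congˡ (vanish (toℕ v)) ⟩
          (ζ ^ toℕ v) ^ s * 0# ≈⟨ zeroʳ _ ⟩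
          0# ∎) ⟩
        0# ∎

-- Integers that are bounded and divisible by a large number.

f≤sum : ∀ {n} (f : Fin n → ℕ) i → f i ℕ.≤ sumℕ f
f≤sum {suc n} f i = subst (f i ℕ.≤_) (≡.sym (sumℕ-remove {i = i} f)) (ℕ.m≤m+n (f i) _)

-- This turns a congruence modulo a prime beyond a fixed bound into an equality.
small-multiple : ∀ {q B i} w → i ≡ + q ℤ.* w → ℤ.∣ i ∣ ℕ.≤ B → B ℕ.< q → i ≡ 0ℤ
small-multiple {q} {i = i} w i≡qw i≤B B<q with ℤ.∣ i ∣ ℕ.≟ 0
... | yes ∣i∣≡0 = ℤ.∣i∣≡0⇒i≡0 ∣i∣≡0
... | no ∣i∣≢0 = ⊥-elim (ℕ.<⇒≱ (ℕ.≤-<-trans i≤B B<q) (∣⇒≤ {{ℕ.≢-nonZero ∣i∣≢0}}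
        (divides ℤ.∣ w ∣ (≡.trans (cong ℤ.∣_∣ i≡qw)
            (≡.trans (ℤ.∣i*j∣≡∣i∣*∣j∣ (+ q) w) (ℕ.*-comm q ℤ.∣ w ∣))))))

-- Polynomial identities in R with integer coefficients.

module IntegerSolver {c ℓ} (R : CommutativeRing c ℓ) where
  open CommutativeRing R
  open Integers R

  ι-morphism : CommutativeRing.rawRing ℤ.+-*-commutativeRing -Raw-AlmostCommutative⟶
      fromCommutativeRing R
  ι-morphism = record
    { ⟦_⟧ = ι ; +-homo = ι-+ ; *-homo = ι-* ; -‿homo = ι-neg
    ; 0-homo = refl ; 1-homo = +-identityʳ 1# }

  ι-≈? : ∀ i j → Maybe.Maybe (ι i ≈ ι j)
  ι-≈? i j = Maybe.map (λ i≡j → reflexive (cong ι i≡j)) (dec⇒maybe (i ℤ.≟ j))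

  open import Algebra.Solver.Ring (CommutativeRing.rawRing ℤ.+-*-commutativeRing)
      (fromCommutativeRing R) ι-morphism ι-≈?
    using (solve; _:=_; _:+_; _:*_; :-_; con) public

module Identities {c ℓ} (R : CommutativeRing c ℓ) where
  open CommutativeRing R
  open IntegerSolver R

  gather : ∀ a b g h s q → (b + q * h) + (q * s + (a + q * g)) ≈ (a + b) + q * ((g + h) + s)
  gather = solve 6 (λ a b g h s q →
      (b :+ q :* h) :+ (q :* s :+ (a :+ q :* g)) := (a :+ b) :+ q :* ((g :+ h) :+ s)) refl

  gather-neg : ∀ a g s q → - (q * s + (a + q * g)) ≈ - a + q * - (s + g)
  gather-neg = solve 4 (λ a g s q → :- (q :* s :+ (a :+ q :* g)) := :- a :+ q :* :- (s :+ g)) refl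

  subtract-term : ∀ a x b y → a + x ≈ b + y → a ≈ b + (y + - x)
  subtract-term a x b y eq = begin
    a ≈⟨ solve 2 (λ a x → a := (a :+ x) :+ :- x) refl a x ⟩
    (a + x) + - x ≈⟨ +-congʳ eq ⟩
    (b + y) + - x ≈⟨ +-assoc b y (- x) ⟩
    b + (y + - x) ∎
    where open import Relation.Binary.Reasoning.Setoid setoid

  distribute : ∀ n a q g → n * a + q * (n * g) ≈ n * (a + q * g)
  distribute = solve 4 (λ n a q g → n :* a :+ q :* (n :* g) := n :* (a :+ q :* g)) refl

  distributeʳ : ∀ n e q h → (n + q * h) * e ≈ n * e + q * (h * e)
  distributeʳ = solve 4 (λ n e q h → (n :+ q :* h) :* e := n :* e :+ q :* (h :* e)) refl

  factor : ∀ n e q h g → (n * e + (q * (h * e) + - (q * (n * g)))) + - n * e ≈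
      q * (h * e + - (n * g))
  factor = solve 5 (λ n e q h g →
      (n :* e :+ (q :* (h :* e) :+ :- (q :* (n :* g)))) :+ :- n :* e :=
      q :* (h :* e :+ :- (n :* g))) refl

  factor-neg : ∀ q w → q * w + - q * w ≈ 0#
  factor-neg = solve 2 (λ q w → q :* w :+ :- q :* w := con 0ℤ) refl

-- Conjugating vanishing sums of roots of unity.

module Galois {c ℓ} (R : CommutativeRing c ℓ) (dom : CharZeroDomain R)
  (k : ℕ) .{{_ : NonZero k}} (ζ : CommutativeRing.Carrier R) (prim : IsPrimitiveRoot R k ζ) where
  open CommutativeRing R
  open CharZeroDomain dom using (noZeroDivs)
  open Integers R
  open Domain R dom
  open import Algebra.Properties.CommutativeSemiring.Exp commutativeSemiring
  open import Algebra.Properties.Semiring.Mult semiring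
    using (×-congʳ; ×-assoc-*) renaming (_×_ to _·_)
  open import Algebra.Properties.Semiring.Sum semiring
    using (sum; sum-cong-≋; ∑-comm; *-distribˡ-sum; *-distribʳ-sum)
  open import Algebra.Properties.CommutativeSemigroup *-commutativeSemigroup
    using () renaming (x∙yz≈y∙xz to x*yz≈y*xz)
  open import Algebra.Properties.Ring ring
    using (-‿distribˡ-*; -‿distribʳ-*; +-inverseˡ-unique; x∙y⁻¹≈ε⇒x≈y)
  open import Relation.Binary.Reasoning.Setoid setoid

  open Combinations R dom k ζ prim
  open Identities R

  -- The congruence ψ^q ≡ ψ(x^q) modulo q. The quotient `g` has to be a `Comb`, because divisibility
  -- by q in R says nothing when q is invertible there.
  FrobeniusLift : ℕ → (ℕ → Carrier) → Set (c ⊔ ℓ)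
  FrobeniusLift q ψ = Σ (ℕ → Carrier) λ g → Comb g × (∀ v → ψ v ^ q ≈ ψ (q ℕ.* v) + ι (+ q) * g v)

  0^n≈0 : ∀ n .{{_ : NonZero n}} → 0# ^ n ≈ 0#
  0^n≈0 (suc n) = zeroˡ _

  module Frobenius {q} (pq : Prime q) where
    Q : Carrier
    Q = ι (+ q)

    0^q≈0 : 0# ^ q ≈ 0#
    0^q≈0 = 0^n≈0 q {{prime⇒nonZero pq}}

    abstract
      -- The middle terms of the binomial expansion are q times an integer polynomial in ψ and φ,
      -- hence q times a `Comb`.
      mixed : ∀ {ψ φ} → Comb ψ → Comb φ → Σ (ℕ → Carrier) λ s → Comb s ×
        (∀ v → (ψ v + φ v) ^ q ≈ φ v ^ q + (Q * s v + ψ v ^ q))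
      mixed {ψ} {φ} combψ combφ with Freshman.freshman commutativeSemiring pq
      ... | m , d , expansion = s
        , comb-sum (λ i → comb-· (d i)
            (comb-* (comb-^ (suc (toℕ i)) combψ) (comb-^ (q ℕ.∸ suc (toℕ i)) combφ)))
        , λ v → trans (expansion (ψ v) (φ v)) (+-congˡ (+-congʳ
            (sym (trans (×-assoc-* q 1# (s v)) (×-congʳ q (*-identityˡ (s v)))))))
        where
        s : ℕ → Carrier
        s v = sum (λ i → d i · (ψ v ^ suc (toℕ i) * φ v ^ (q ℕ.∸ suc (toℕ i))))

      frobenius-resp : ∀ {ψ φ} → (∀ v → ψ v ≈ φ v) → FrobeniusLift q φ → FrobeniusLift q ψ
      frobenius-resp ψ≈φ (g , combg , lift) = g , combg , λ v →
        trans (^-congˡ q (ψ≈φ v)) (trans (lift v) (+-congʳ (sym (ψ≈φ (q ℕ.* v)))))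

      frobenius-0 : FrobeniusLift q (λ _ → 0#)
      frobenius-0 = (λ _ → 0#) , comb-0 , λ v → trans 0^q≈0 (sym (trans (+-identityˡ _) (zeroʳ Q)))

      frobenius-+ : ∀ {ψ φ} → Comb ψ → Comb φ → FrobeniusLift q ψ → FrobeniusLift q φ →
                    FrobeniusLift q (λ v → ψ v + φ v)
      frobenius-+ {ψ} {φ} combψ combφ (g , combg , liftψ) (h , combh , liftφ) with mixed combψ combφ
      ... | s , combs , expansion = (λ v → (g v + h v) + s v) ,
          comb-+ (comb-+ combg combh) combs , λ v → begin
        (ψ v + φ v) ^ q ≈⟨ expansion v ⟩
        φ v ^ q + (Q * s v + ψ v ^ q) ≈⟨ +-cong (liftφ v) (+-congˡ (liftψ v)) ⟩
        (φ (q ℕ.* v) + Q * h v) + (Q * s v + (ψ (q ℕ.* v) + Q * g v)) ≈⟨ gather _ _ _ _ _ _ ⟩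
        (ψ (q ℕ.* v) + φ (q ℕ.* v)) + Q * ((g v + h v) + s v) ∎

      -- Expanding (ψ + (-ψ))^q = 0 isolates (-ψ)^q, which avoids separating q = 2 from the odd
      -- primes.
      frobenius-neg : ∀ {ψ} → Comb ψ → FrobeniusLift q ψ → FrobeniusLift q (λ v → - ψ v)
      frobenius-neg {ψ} combψ (g , combg , lift) with mixed combψ (comb-neg combψ)
      ... | s , combs , expansion = (λ v → - (s v + g v)) , comb-neg (comb-+ combs combg) , λ v →
          begin
        (- ψ v) ^ q
          ≈⟨ +-inverseˡ-unique _ _ (trans (sym (expansion v))
              (trans (^-congˡ q (-‿inverseʳ (ψ v))) 0^q≈0)) ⟩
        - (Q * s v + ψ v ^ q) ≈⟨ -‿cong (+-congˡ (lift v)) ⟩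
        - (Q * s v + (ψ (q ℕ.* v) + Q * g v)) ≈⟨ gather-neg _ _ _ _ ⟩
        - ψ (q ℕ.* v) + Q * - (s v + g v) ∎

      -- By repeated addition of ψ; for ψ = 1 this contains Fermat's little theorem.
      frobenius-scale-pos : ∀ {ψ} n → Comb ψ → FrobeniusLift q ψ →
          FrobeniusLift q (λ v → ι (+ n) * ψ v)
      frobenius-scale-pos {ψ} zero combψ lift = frobenius-resp (λ v → zeroˡ (ψ v)) frobenius-0
      frobenius-scale-pos {ψ} (suc n) combψ lift = frobenius-resp
        (λ v → trans (distribʳ (ψ v) 1# (ι (+ n))) (+-congʳ (*-identityˡ (ψ v))))
        (frobenius-+ combψ (comb-scale (+ n) combψ) lift (frobenius-scale-pos n combψ lift))

      frobenius-scale : ∀ {ψ} a → Comb ψ → FrobeniusLift q ψ → FrobeniusLift q (λ v → ι a * ψ v)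
      frobenius-scale (+ n) combψ lift = frobenius-scale-pos n combψ lift
      frobenius-scale {ψ} -[1+ n ] combψ lift = frobenius-resp
        (λ v → sym (-‿distribˡ-* (ι (+ suc n)) (ψ v)))
        (frobenius-neg (comb-scale (+ suc n) combψ) (frobenius-scale-pos (suc n) combψ lift))

      frobenius-χ : ∀ i → FrobeniusLift q (λ v → (ζ ^ v) ^ i)
      frobenius-χ i = (λ _ → 0#) , comb-0 , λ v → begin
        ((ζ ^ v) ^ i) ^ q ≈⟨ ^-assocʳ (ζ ^ v) i q ⟩
        (ζ ^ v) ^ (i ℕ.* q) ≈⟨ ^-congʳ (ζ ^ v) (ℕ.*-comm i q) ⟩
        (ζ ^ v) ^ (q ℕ.* i) ≈⟨ sym (χ-dilate q v i) ⟩
        (ζ ^ (q ℕ.* v)) ^ i ≈⟨ sym (trans (+-congˡ (zeroʳ Q)) (+-identityʳ _)) ⟩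
        (ζ ^ (q ℕ.* v)) ^ i + Q * 0# ∎

      frobenius-sum : ∀ {n} {ψ : Fin n → ℕ → Carrier} → (∀ i → Comb (ψ i)) →
                      (∀ i → FrobeniusLift q (ψ i)) → FrobeniusLift q (λ v → sum (λ i → ψ i v))
      frobenius-sum {zero} combs lifts = frobenius-0
      frobenius-sum {suc n} combs lifts =
        frobenius-+ (combs Fin.zero) (comb-sum (combs ∘ Fin.suc)) (lifts Fin.zero)
            (frobenius-sum (combs ∘ Fin.suc) (lifts ∘ Fin.suc))

      -- Monomials satisfy the congruence exactly, with quotient 0, and it passes to integer
      -- multiples and sums.
      frobenius : ∀ {ψ} → Comb ψ → FrobeniusLift q ψ
      frobenius (c , ψ≈) = frobenius-resp ψ≈ (frobenius-sum
        (λ i → comb-scale (c i) (comb-χ (toℕ i)))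
            (λ i → frobenius-scale (c i) (comb-χ (toℕ i)) (frobenius-χ (toℕ i))))

  open Frobenius using (frobenius)

  -- E is N times an idempotent; keeping N as a factor avoids denominators.
  module Invariance (N : ℤ) (N≢0 : N ≢ 0ℤ) (E : ℕ → Carrier) (combE : Comb E)
                    (idempotent : ∀ v → E v * E v ≈ ι N * E v) where

    -- The factor `ι N` on the left takes the place of the exponent n - 1 in E^n = N^(n-1) E.
    idempotent-^ : ∀ v n .{{_ : NonZero n}} → ι N * E v ^ n ≈ ι N ^ n * E v
    idempotent-^ v 1 = trans (*-congˡ (*-identityʳ _)) (*-congʳ (sym (*-identityʳ _)))
    idempotent-^ v (suc n@(suc _)) = begin
      ι N * (E v * E v ^ n) ≈⟨ x*yz≈y*xz (ι N) (E v) (E v ^ n) ⟩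
      E v * (ι N * E v ^ n) ≈⟨ *-congˡ (idempotent-^ v n) ⟩
      E v * (ι N ^ n * E v) ≈⟨ x*yz≈y*xz (E v) (ι N ^ n) (E v) ⟩
      ι N ^ n * (E v * E v) ≈⟨ *-congˡ (idempotent v) ⟩
      ι N ^ n * (ι N * E v) ≈⟨ sym (*-assoc _ _ _) ⟩
      ι N ^ n * ι N * E v ≈⟨ *-congʳ (*-comm _ _) ⟩
      ι N ^ suc n * E v ∎

    -- This is N (E(x^s) - E). The factor N is present because the congruence modulo q is derived
    -- for N E only.
    difference : ℕ → ℕ → Carrier
    difference s v = ι N * E (s ℕ.* v) + ι (ℤ.- N) * E v

    comb-difference : ∀ s → Comb (difference s)
    comb-difference s = comb-+ (comb-scale N (comb-dilate s combE)) (comb-scale (ℤ.- N) combE)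

    abstract
      divisible : ∀ {q} → Prime q → Σ (ℕ → Carrier) λ w →
          Comb w × (∀ v → difference q v ≈ ι (+ q) * w v)
      -- The second congruence, for the constant N, is Fermat's N^q ≡ N modulo q.
      divisible {q} pq with frobenius pq combE | frobenius pq (comb-scale N comb-1)
      ... | g , combg , liftE | h , combh , liftN =
        (λ v → h v * E v + - (ι N * g v)) ,
            comb-+ (comb-* combh combE) (comb-neg (comb-scale N combg)) , λ v → begin
          ι N * E (q ℕ.* v) + ι (ℤ.- N) * E v
            ≈⟨ +-cong (subtract-term _ _ _ _ (congruence v)) (*-congʳ (ι-neg N)) ⟩
          (ι N * E v + (Q * (h v * E v) + - (Q * (ι N * g v)))) + - ι N * E v ≈⟨ factor _ _ _ _ _ ⟩
          Q * (h v * E v + - (ι N * g v)) ∎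
        where
        Q : Carrier
        Q = ι (+ q)
        N^q≈ : ∀ v → ι N ^ q ≈ ι N + Q * h v
        N^q≈ v = trans (^-congˡ q (sym (*-identityʳ (ι N))))
            (trans (liftN v) (+-congʳ (*-identityʳ (ι N))))
        congruence : ∀ v → ι N * E (q ℕ.* v) + Q * (ι N * g v) ≈ ι N * E v + Q * (h v * E v)
        congruence v = begin
          ι N * E (q ℕ.* v) + Q * (ι N * g v) ≈⟨ distribute _ _ _ _ ⟩
          ι N * (E (q ℕ.* v) + Q * g v) ≈⟨ *-congˡ (sym (liftE v)) ⟩
          ι N * E v ^ q ≈⟨ idempotent-^ v q {{prime⇒nonZero pq}} ⟩
          ι N ^ q * E v ≈⟨ *-congʳ (N^q≈ v) ⟩
          (ι N + Q * h v) * E v ≈⟨ distributeʳ _ _ _ _ ⟩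
          ι N * E v + Q * (h v * E v) ∎

    coefficients : ℕ → Fin k → ℤ
    coefficients s = proj₁ (comb-difference s)

    -- Only the residue of s modulo k matters for difference s, which makes the
    -- coefficients bounded uniformly in s.
    bound : ℕ
    bound = sumℕ {k} (λ s → sumℕ {k} (λ i → ℤ.∣ coefficients (toℕ s) i ∣))

    coefficient≤bound : ∀ s i → ℤ.∣ coefficients (s % k) i ∣ ℕ.≤ bound
    coefficient≤bound s i = ℕ.≤-trans (f≤sum (λ i → ℤ.∣ coefficients (s % k) i ∣) i)
      (subst (λ z → sumℕ {k} (λ i → ℤ.∣ coefficients z i ∣) ℕ.≤ bound) (toℕ-fromℕ< (m%n<n s k))
        (f≤sum (λ s → sumℕ {k} (λ i → ℤ.∣ coefficients (toℕ s) i ∣)) (fromℕ< (m%n<n s k))))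

    -- The coefficients chosen for the residue s of q, and q times those of the quotient `w`,
    -- represent the same function, so they agree by `expand-injective`. Being divisible by q and at
    -- most `bound` in absolute value, they vanish; then N is cancelled.
    invariant : ∀ {q} → Prime q → bound ℕ.< q → ∀ v → E (q ℕ.* v) ≈ E v
    invariant {q} pq bound<q v with divisible pq
    ... | w , (d , w≈) , difference≈ = trans (sym (comb-cong-% combE _ _ (residue-* v))) (fixed v)
      where
      s : ℕ
      s = q % k
      residue-* : ∀ v → (s ℕ.* v) % k ≡ (q ℕ.* v) % k
      residue-* v = ≡.trans (%-distribˡ-* s v k)
        (≡.trans (cong (λ z → (z ℕ.* (v % k)) % k) (m%n%n≡m%n q k)) (≡.sym (%-distribˡ-* q v k)))
      cs : Fin k → ℤ
      cs = coefficients s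
      relation : ∀ v → expand (λ i → cs i ℤ.+ ℤ.- (+ q) ℤ.* d i) v ≈ 0#
      relation v = begin
        expand (λ i → cs i ℤ.+ ℤ.- (+ q) ℤ.* d i) v
          ≈⟨ sym (trans (+-congˡ (expand-scale (ℤ.- (+ q)) d v))
              (expand-+ cs (λ i → ℤ.- (+ q) ℤ.* d i) v)) ⟩
        expand cs v + ι (ℤ.- (+ q)) * expand d v
          ≈⟨ sym (+-cong (proj₂ (comb-difference s) v) (*-congˡ (w≈ v))) ⟩
        difference s v + ι (ℤ.- (+ q)) * w v
          ≈⟨ +-cong (trans (+-congʳ (*-congˡ (comb-cong-% combE _ _ (residue-* v))))
              (difference≈ v)) (*-congʳ (ι-neg (+ q))) ⟩
        ι (+ q) * w v + - ι (+ q) * w v ≈⟨ factor-neg _ _ ⟩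
        0# ∎
      cs≡0 : ∀ i → cs i ≡ 0ℤ
      cs≡0 i = small-multiple (d i) cs≡qd (coefficient≤bound q i) bound<q
        where
        cs≡qd : cs i ≡ + q ℤ.* d i
        cs≡qd = ℤ.i-j≡0⇒i≡j (cs i) (+ q ℤ.* d i)
          (≡.trans (cong (λ z → cs i ℤ.+ z) (ℤ.neg-distribˡ-* (+ q) (d i)))
              (expand-injective (λ i → cs i ℤ.+ ℤ.- (+ q) ℤ.* d i) relation i))
      fixed : ∀ v → E (s ℕ.* v) ≈ E v
      fixed v = x∙y⁻¹≈ε⇒x≈y _ _ (ι-cancel N≢0 (begin
        ι N * (E (s ℕ.* v) + - E v) ≈⟨ distribˡ _ _ _ ⟩
        ι N * E (s ℕ.* v) + ι N * - E v
          ≈⟨ +-congˡ (trans (sym (-‿distribʳ-* _ _))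
              (trans (-‿distribˡ-* _ _) (*-congʳ (sym (ι-neg N))))) ⟩
        difference s v ≈⟨ proj₂ (comb-difference s) v ⟩
        expand cs v
          ≈⟨ sum-zero {k} _ (λ i → trans (*-congʳ (reflexive (cong ι (cs≡0 i)))) (zeroˡ _)) ⟩
        0# ∎))

    invariant-product : ∀ ps → All Prime ps → (∀ q → Prime q → q ∣ product ps → bound ℕ.< q) →
                        ∀ v → E (product ps ℕ.* v) ≈ E v
    invariant-product [] [] rough v = reflexive (cong E (ℕ.*-identityˡ v))
    invariant-product (p ∷ ps) (pp ∷ pps) rough v = begin
      E (p ℕ.* product ps ℕ.* v) ≡⟨ cong E (ℕ.*-assoc p (product ps) v) ⟩
      E (p ℕ.* (product ps ℕ.* v))
        ≈⟨ invariant pp (rough p pp (m∣m*n (product ps))) (product ps ℕ.* v) ⟩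
      E (product ps ℕ.* v) ≈⟨ invariant-product ps pps (λ q pq q∣ → rough q pq (∣n⇒∣m*n p q∣)) v ⟩
      E v ∎

    invariant-rough : ∀ U .{{_ : NonZero U}} → (∀ q → Prime q → q ∣ U → bound ℕ.< q) → E U ≈ E 1
    invariant-rough U rough = begin
      E U ≡⟨ cong E (≡.trans isFactorisation (≡.sym (ℕ.*-identityʳ _))) ⟩
      E (product factors ℕ.* 1) ≈⟨ invariant-product factors factorsPrime
        (λ q pq q∣ → rough q pq (subst (q ∣_) (≡.sym isFactorisation) q∣)) 1 ⟩
      E 1 ∎
      where open PrimeFactorisation (factorise U)

  ι-sum : ∀ {n} (f : Fin n → ℤ) → ι (sumℤ f) ≈ sum (λ i → ι (f i))
  ι-sum {zero} f = refl
  ι-sum {suc n} f = trans (ι-+ (f Fin.zero) _) (+-congˡ (ι-sum (f ∘ Fin.suc)))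

  module _ {f : ℕ → Carrier} (combf : Comb f) where

    -- The powers f^0, ..., f^k have k + 1 coefficient vectors in ℤ^k. A relation among these
    -- vectors holds for the values at all v at once.
    power-relation : Σ (Fin (suc k) → ℤ) λ c → (∃ λ i → c i ≢ 0ℤ) ×
                     (∀ v → sum (λ i → ι (c i) * f v ^ toℕ i) ≈ 0#)
    power-relation = γ , nonzero , relation
      where
      coeff : Fin (suc k) → Fin k → ℤ
      coeff i = proj₁ (comb-^ (toℕ i) combf)
      dependence = LinearDependence.dependent k coeff
      γ = proj₁ dependence
      nonzero = proj₁ (proj₂ dependence)
      relation : ∀ v → sum (λ i → ι (γ i) * f v ^ toℕ i) ≈ 0#
      relation v = begin
        sum (λ i → ι (γ i) * f v ^ toℕ i)
          ≈⟨ sum-cong-≋ {suc k} (λ i → trans (*-congˡ (proj₂ (comb-^ (toℕ i) combf) v))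
              (expand-scale (γ i) (coeff i) v)) ⟩
        sum {suc k} (λ i → sum {k} (λ j → ι (γ i ℤ.* coeff i j) * x ^ toℕ j))
          ≈⟨ ∑-comm {suc k} {k} (λ i j → ι (γ i ℤ.* coeff i j) * x ^ toℕ j) ⟩
        sum {k} (λ j → sum {suc k} (λ i → ι (γ i ℤ.* coeff i j) * x ^ toℕ j))
          ≈⟨ sum-zero {k} _ (λ j → begin
          sum {suc k} (λ i → ι (γ i ℤ.* coeff i j) * x ^ toℕ j)
            ≈⟨ sym (*-distribʳ-sum {suc k} (x ^ toℕ j) (λ i → ι (γ i ℤ.* coeff i j))) ⟩
          sum {suc k} (λ i → ι (γ i ℤ.* coeff i j)) * x ^ toℕ j
            ≈⟨ *-congʳ (sym (ι-sum {suc k} (λ i → γ i ℤ.* coeff i j))) ⟩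
          ι (sumℤ {suc k} (λ i → γ i ℤ.* coeff i j)) * x ^ toℕ j
            ≡⟨ cong (λ z → ι z * x ^ toℕ j) (proj₂ (proj₂ dependence) j) ⟩
          0# * x ^ toℕ j ≈⟨ zeroˡ _ ⟩
          0# ∎) ⟩
        0# ∎
        where x = ζ ^ v

    sum-tail : ∀ {n} (c : Fin (suc n) → ℤ) v → sum (λ i → ι (c (Fin.suc i)) * f v ^ suc (toℕ i)) ≈
               f v * sum (λ i → ι (c (Fin.suc i)) * f v ^ toℕ i)
    sum-tail {n} c v = trans (sum-cong-≋ {n}
        (λ i → x*yz≈y*xz (ι (c (Fin.suc i))) (f v) (f v ^ toℕ i)))
      (sym (*-distribˡ-sum {n} (f v) (λ i → ι (c (Fin.suc i)) * f v ^ toℕ i)))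

    -- If N is the lowest nonzero coefficient, the relation reads f^j (N + f g) = 0. At each v
    -- either f(v) = 0 or N = f(v) b(v), where b = -g is one `Comb` that serves all v.
    invert-lowest : ∀ {n} (c : Fin n → ℤ) → (∃ λ i → c i ≢ 0ℤ) →
      Σ ℤ λ N → Σ (ℕ → Carrier) λ b → N ≢ 0ℤ × Comb b ×
      (∀ v → sum (λ i → ι (c i) * f v ^ toℕ i) ≈ 0# → f v ≈ 0# ⊎ ι N ≈ f v * b v)
    invert-lowest {suc n} c nonzero with c Fin.zero ℤ.≟ 0ℤ
    ... | no c₀≢0 = c Fin.zero , (λ v → - tail v) , c₀≢0
      , comb-neg (comb-sum (λ i → comb-scale (c (Fin.suc i)) (comb-^ (toℕ i) combf)))
      , λ v eq → inj₂ (begin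
          ι (c Fin.zero) ≈⟨ sym (*-identityʳ _) ⟩
          ι (c Fin.zero) * 1# ≈⟨ +-inverseˡ-unique _ _ (trans (+-congˡ (sym (sum-tail c v))) eq) ⟩
          - (f v * tail v) ≈⟨ -‿distribʳ-* _ _ ⟩
          f v * - tail v ∎)
      where
      tail : ℕ → Carrier
      tail v = sum (λ i → ι (c (Fin.suc i)) * f v ^ toℕ i)
    ... | yes c₀≡0 with invert-lowest (c ∘ Fin.suc) (shift nonzero)
      where
      shift : (∃ λ i → c i ≢ 0ℤ) → ∃ λ i → c (Fin.suc i) ≢ 0ℤ
      shift (Fin.zero , c₀≢0) = ⊥-elim (c₀≢0 c₀≡0)
      shift (Fin.suc i , ci≢0) = i , ci≢0
    ...   | N , b , N≢0 , combb , inverse = N , b , N≢0 , combb , λ v eq →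
        descend v (noZeroDivs (f v) _ (begin
        f v * sum (λ i → ι (c (Fin.suc i)) * f v ^ toℕ i) ≈⟨ sym (sum-tail c v) ⟩
        sum (λ i → ι (c (Fin.suc i)) * f v ^ suc (toℕ i)) ≈⟨ sym (+-identityˡ _) ⟩
        0# + sum (λ i → ι (c (Fin.suc i)) * f v ^ suc (toℕ i))
          ≈⟨ +-congʳ (sym (trans (*-congʳ (reflexive (cong ι c₀≡0))) (zeroˡ 1#))) ⟩
        sum (λ i → ι (c i) * f v ^ toℕ i) ≈⟨ eq ⟩
        0# ∎))
      where
      descend : ∀ v → f v ≈ 0# ⊎ sum (λ i → ι (c (Fin.suc i)) * f v ^ toℕ i) ≈ 0# →
                f v ≈ 0# ⊎ ι N ≈ f v * b v
      descend v (inj₁ f≈0) = inj₁ f≈0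
      descend v (inj₂ tail≈0) = inverse v tail≈0

    -- Both alternatives of `invert-lowest` imply this equation, so the case distinction at each v
    -- disappears. Up to the factor N, `b` is a quasi-inverse of `f` as in a von Neumann regular
    -- ring.
    regular : Σ ℤ λ N → Σ (ℕ → Carrier) λ b →
        N ≢ 0ℤ × Comb b × (∀ v → ι N * f v ≈ f v * (f v * b v))
    regular with power-relation
    ... | c , nonzero , relation with invert-lowest c nonzero
    ...   | N , b , N≢0 , combb , inverse = N , b , N≢0 , combb , λ v →
        equation v (inverse v (relation v))
      where
      equation : ∀ v → f v ≈ 0# ⊎ ι N ≈ f v * b v → ι N * f v ≈ f v * (f v * b v)
      equation v (inj₁ f≈0) = trans (trans (*-congˡ f≈0) (zeroʳ _))
          (sym (trans (*-congʳ f≈0) (zeroˡ _)))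
      equation v (inj₂ N≈fb) = trans (*-comm _ _) (*-congˡ N≈fb)

    -- For E = f b the zero of f at 1 gives E(1) = 0, invariance carries this over to E(U), and N f
    -- = f E leads back to f(U).
    vanishing-rough : f 1 ≈ 0# → ∃ λ B → ∀ U .{{_ : NonZero U}} →
        (∀ q → Prime q → q ∣ U → B ℕ.< q) → f U ≈ 0#
    vanishing-rough f1≈0 with regular
    ... | N , b , N≢0 , combb , equation = bound , λ U rough → ι-cancel N≢0 (begin
        ι N * f U ≈⟨ equation U ⟩
        f U * E U ≈⟨ *-congˡ (trans (invariant-rough U rough) (trans (*-congʳ f1≈0) (zeroˡ _))) ⟩
        f U * 0# ≈⟨ zeroʳ _ ⟩
        0# ∎)
      where
      E : ℕ → Carrier
      E v = f v * b v
      idempotent : ∀ v → E v * E v ≈ ι N * E v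
      idempotent v = begin
        E v * (f v * b v) ≈⟨ trans (sym (*-assoc _ _ _)) (*-congʳ (*-comm _ _)) ⟩
        f v * E v * b v ≈⟨ *-congʳ (sym (equation v)) ⟩
        ι N * f v * b v ≈⟨ *-assoc _ _ _ ⟩
        ι N * E v ∎
      open Invariance N N≢0 E (comb-* combf combb) idempotent

    -- The number 1 + t u may have small prime factors. `rough-progression` supplies one without
    -- them in the same class modulo k, and f depends only on this class.
    vanishing-progression : ∀ {p t} → Prime p → p ∣ t → k ≡ p ℕ.* t → f 1 ≈ 0# → ∀ u →
        f (1 ℕ.+ t ℕ.* u) ≈ 0#
    vanishing-progression {p} {t} pp p∣t k≡pt f1≈0 u with vanishing-rough f1≈0
    ... | B , vanish with rough-progression pp p∣t B u
    ...   | a , rough = trans (comb-cong-% combf (1 ℕ.+ t ℕ.* u)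
        (1 ℕ.+ t ℕ.* (u ℕ.+ a ℕ.* p)) residue) (vanish _ rough)
      where
      regroup : ∀ t u a p → 1 ℕ.+ t ℕ.* (u ℕ.+ a ℕ.* p) ≡ 1 ℕ.+ t ℕ.* u ℕ.+ a ℕ.* (p ℕ.* t)
      regroup = solveℕ-∀
      residue : (1 ℕ.+ t ℕ.* u) % k ≡ (1 ℕ.+ t ℕ.* (u ℕ.+ a ℕ.* p)) % k
      residue = ≡.sym (≡.trans (cong (_% k)
          (≡.trans (regroup t u a p) (cong (λ z → 1 ℕ.+ t ℕ.* u ℕ.+ a ℕ.* z) (≡.sym k≡pt))))
        ([m+kn]%n≡m%n (1 ℕ.+ t ℕ.* u) a k))

-- Gram matrices and sums over blocks.

module Matrices {c ℓ} (R : CommutativeRing c ℓ) (dom : CharZeroDomain R) where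
  open CommutativeRing R
  open Integers R using (natR≡×)
  open Domain R dom
  open import Algebra.Properties.CommutativeSemiring.Exp commutativeSemiring
  open import Algebra.Properties.Semiring.Mult semiring using (×-assocˡ) renaming (_×_ to _·_)
  open import Algebra.Properties.Semiring.Sum semiring
    using (sum; sum-cong-≋; ∑-comm; *-distribˡ-sum; *-distribʳ-sum; sum-replicate)
  open import Algebra.Properties.CommutativeSemigroup *-commutativeSemigroup using (interchange)
  open import Relation.Binary.Reasoning.Setoid setoid

  sumR≡sum : ∀ n f → sumR R n f ≡ sum f
  sumR≡sum zero f = ≡.refl
  sumR≡sum (suc n) f = cong (λ z → f Fin.zero + z) (sumR≡sum n (f ∘ Fin.suc))

  sum-++ : ∀ m n (f : Fin (m ℕ.+ n) → Carrier) → sum f ≈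
      sum (λ i → f (i ↑ˡ n)) + sum (λ j → f (m ↑ʳ j))
  sum-++ zero n f = sym (+-identityˡ _)
  sum-++ (suc m) n f = trans (+-congˡ (sum-++ m n (f ∘ Fin.suc))) (sym (+-assoc _ _ _))

  sum-combine : ∀ m n (f : Fin (m ℕ.* n) → Carrier) → sum f ≈
      sum {m} (λ u → sum {n} (λ j → f (combine u j)))
  sum-combine zero n f = refl
  sum-combine (suc m) n f = trans (sum-++ n (m ℕ.* n) f)
      (+-congˡ (sum-combine m n (λ i → f (n ↑ʳ i))))

  inverse-^ : ∀ {x y} → x * y ≈ 1# → ∀ n → x ^ n * y ^ n ≈ 1#
  inverse-^ {x} {y} xy≈1 n = trans (sym (^-distrib-* x y n)) (trans (^-congˡ n xy≈1) (1^n≈1 n))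

  ^-∸ : ∀ {x y k b} → x ^ k ≈ 1# → x * y ≈ 1# → b ℕ.≤ k → x ^ (k ℕ.∸ b) ≈ y ^ b
  ^-∸ {x} {y} {k} {b} root xy≈1 b≤k = begin
    x ^ (k ℕ.∸ b) ≈⟨ sym (trans (*-congˡ (inverse-^ xy≈1 b)) (*-identityʳ _)) ⟩
    x ^ (k ℕ.∸ b) * (x ^ b * y ^ b) ≈⟨ sym (*-assoc _ _ _) ⟩
    (x ^ (k ℕ.∸ b) * x ^ b) * y ^ b
      ≈⟨ *-congʳ (trans (sym (^-homo-* x (k ℕ.∸ b) b)) (^-congʳ x (ℕ.m∸n+n≡m b≤k))) ⟩
    x ^ k * y ^ b ≈⟨ trans (*-congʳ root) (*-identityˡ _) ⟩
    y ^ b ∎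

  -- Writing the conjugated entries as powers of an explicit inverse `y` removes the truncated
  -- subtraction from the Gram matrix.
  HHstar-inverse : ∀ {k x y} → x ^ k ≈ 1# → x * y ≈ 1# → ∀ {n} (H : Fin n → Fin n → Fin k) i l →
    HHstar R k x H i l ≈ sum (λ j → x ^ toℕ (H i j) * y ^ toℕ (H l j))
  HHstar-inverse {k} {x} {y} root xy≈1 {n} H i l = trans
    (reflexive (sumR≡sum n _))
    (sum-cong-≋ {n} (λ j → *-cong (reflexive (pow≡^ x (toℕ (H i j))))
      (trans (reflexive (pow≡^ x (k ℕ.∸ toℕ (H l j)))) (^-∸ root xy≈1 (ℕ.<⇒≤ (toℕ<n (H l j)))))))

  HHstar-cong : ∀ {k x y} → x ≈ y → ∀ {n} (H : Fin n → Fin n → Fin k) i l → HHstar R k x H i l ≈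
      HHstar R k y H i l
  HHstar-cong {k} {x} {y} x≈y {n} H i l = begin
    HHstar R k x H i l ≡⟨ sumR≡sum n _ ⟩
    sum (λ j → pow R x (toℕ (H i j)) * pow R x (k ℕ.∸ toℕ (H l j)))
      ≈⟨ sum-cong-≋ {n} (λ j → *-cong (pow-cong (toℕ (H i j))) (pow-cong (k ℕ.∸ toℕ (H l j)))) ⟩
    sum (λ j → pow R y (toℕ (H i j)) * pow R y (k ℕ.∸ toℕ (H l j))) ≡⟨ ≡.sym (sumR≡sum n _) ⟩
    HHstar R k y H i l ∎
    where
    pow-cong : ∀ e → pow R x e ≈ pow R y e
    pow-cong e = trans (reflexive (pow≡^ x e))
        (trans (^-congˡ e x≈y) (reflexive (≡.sym (pow≡^ y e))))

  δ-diagonal : ∀ {n} N (i : Fin n) → δ R N i i ≡ natR R N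
  δ-diagonal N i with i ≟ᶠ i
  ... | yes _ = ≡.refl
  ... | no i≢i = ⊥-elim (i≢i ≡.refl)

  δ-off-diagonal : ∀ {n} N {i l : Fin n} → i ≢ l → δ R N i l ≡ 0#
  δ-off-diagonal N {i} {l} i≢l with i ≟ᶠ l
  ... | yes i≡l = ⊥-elim (i≢l i≡l)
  ... | no _ = ≡.refl

  -- The construction for a prime m = p.

  module PrimeStep {p t} (pp : Prime p) (p∣t : p ∣ t) .{{_ : NonZero t}}
    (ζ : Carrier) (prim : IsPrimitiveRoot R (p ℕ.* t) ζ)
    {n} (H : Fin n → Fin n → Fin (p ℕ.* t)) (isBH : IsBH R n (p ℕ.* t) ζ H) where

    k : ℕ
    k = p ℕ.* t
    instance
      p≢0 : NonZero p
      p≢0 = prime⇒nonZero pp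
      k≢0 : NonZero k
      k≢0 = ℕ.m*n≢0 p t
    open Galois R dom k ζ prim using (vanishing-progression)
    open Combinations R dom k ζ prim using (ζ^k≈1; ζ^-injective; Comb; comb-resp; comb-sum; comb-χ)

    -- R carries no conjugation, so the conjugate of ζ is taken to be its inverse, written as a
    -- power of ζ.
    ζ̄ : Carrier
    ζ̄ = ζ ^ (k ℕ.∸ 1)

    ζζ̄≈1 : ζ * ζ̄ ≈ 1#
    ζζ̄≈1 = trans (^-congʳ ζ (ℕ.suc-pred k)) ζ^k≈1

    -- With τ = t / p the root of unity η = ζ^t equals ω^τ, so the Fourier matrix has its entries
    -- among the powers of ω.
    τ : ℕ
    τ = quotient p∣t

    t≡pτ : t ≡ p ℕ.* τ
    t≡pτ = m∣n⇒n≡m*quotient p∣t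

    mixed-power : ∀ a a′ b b′ u → ζ ^ (a ℕ.+ a′ ℕ.* u) * ζ̄ ^ (b ℕ.+ b′ ℕ.* u) ≈
        (ζ ^ a * ζ̄ ^ b) * (ζ ^ a′ * ζ̄ ^ b′) ^ u
    mixed-power a a′ b b′ u = begin
      ζ ^ (a ℕ.+ a′ ℕ.* u) * ζ̄ ^ (b ℕ.+ b′ ℕ.* u) ≈⟨ *-cong (split ζ a a′) (split ζ̄ b b′) ⟩
      (ζ ^ a * (ζ ^ a′) ^ u) * (ζ̄ ^ b * (ζ̄ ^ b′) ^ u) ≈⟨ interchange _ _ _ _ ⟩
      (ζ ^ a * ζ̄ ^ b) * ((ζ ^ a′) ^ u * (ζ̄ ^ b′) ^ u)
        ≈⟨ *-congˡ (sym (^-distrib-* (ζ ^ a′) (ζ̄ ^ b′) u)) ⟩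
      (ζ ^ a * ζ̄ ^ b) * (ζ ^ a′ * ζ̄ ^ b′) ^ u ∎
      where
      split : ∀ x a a′ → x ^ (a ℕ.+ a′ ℕ.* u) ≈ x ^ a * (x ^ a′) ^ u
      split x a a′ = trans (^-homo-* x a (a′ ℕ.* u)) (*-congˡ (sym (^-assocʳ x a′ u)))

    -- This is η^(X-Y) for the primitive p-th root of unity η = ζ^t.
    ratio : ℕ → ℕ → Carrier
    ratio X Y = ζ ^ (X ℕ.* t) * ζ̄ ^ (Y ℕ.* t)

    ratio-root : ∀ X Y → ratio X Y ^ p ≈ 1#
    ratio-root X Y = begin
      ratio X Y ^ p ≈⟨ ^-distrib-* _ _ p ⟩
      (ζ ^ (X ℕ.* t)) ^ p * (ζ̄ ^ (Y ℕ.* t)) ^ p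
        ≈⟨ *-cong (root ζ ζ^k≈1 X) (root ζ̄ (root-^ ζ k ζ^k≈1 (k ℕ.∸ 1)) Y) ⟩
      1# * 1# ≈⟨ *-identityˡ _ ⟩
      1# ∎
      where
      regroup : ∀ X t p → X ℕ.* t ℕ.* p ≡ X ℕ.* (p ℕ.* t)
      regroup = solveℕ-∀
      root : ∀ x → x ^ k ≈ 1# → ∀ X → (x ^ (X ℕ.* t)) ^ p ≈ 1#
      root x x^k≈1 X = begin
        (x ^ (X ℕ.* t)) ^ p ≈⟨ ^-assocʳ x (X ℕ.* t) p ⟩
        x ^ (X ℕ.* t ℕ.* p) ≈⟨ ^-congʳ x (regroup X t p) ⟩
        x ^ (X ℕ.* k) ≈⟨ sym (^-assocʳ x X k) ⟩
        (x ^ X) ^ k ≈⟨ root-^ x k x^k≈1 X ⟩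
        1# ∎

    -- Primitivity of ζ gives X t ≡ Y t modulo p t, and t cancels.
    ratio≈1⇒ : ∀ X Y → ratio X Y ≈ 1# → X % p ≡ Y % p
    ratio≈1⇒ X Y eq = ℕ.*-cancelʳ-≡ (X % p) (Y % p) t (≡.trans (m%n*o≡m*o%[n*o] X p t)
      (≡.trans (ζ^-injective (X ℕ.* t) (Y ℕ.* t) (begin
        ζ ^ (X ℕ.* t) ≈⟨ sym (*-identityʳ _) ⟩
        ζ ^ (X ℕ.* t) * 1# ≈⟨ *-congˡ (sym (trans (*-comm _ _) (inverse-^ ζζ̄≈1 (Y ℕ.* t)))) ⟩
        ζ ^ (X ℕ.* t) * (ζ̄ ^ (Y ℕ.* t) * ζ ^ (Y ℕ.* t)) ≈⟨ sym (*-assoc _ _ _) ⟩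
        ratio X Y * ζ ^ (Y ℕ.* t) ≈⟨ trans (*-congʳ eq) (*-identityˡ _) ⟩
        ζ ^ (Y ℕ.* t) ∎)) (≡.sym (m%n*o≡m*o%[n*o] Y p t))))

    sum-ratio≈0 : ∀ X Y → X % p ≢ Y % p → ∀ γ → sum {p} (λ u → γ * ratio X Y ^ toℕ u) ≈ 0#
    sum-ratio≈0 X Y X≢Y γ = begin
      sum {p} (λ u → γ * ratio X Y ^ toℕ u)
        ≈⟨ sym (*-distribˡ-sum {p} γ (λ u → ratio X Y ^ toℕ u)) ⟩
      γ * sum {p} (λ u → ratio X Y ^ toℕ u)
        ≈⟨ *-congˡ (sum-powers≈0 _ p (ratio-root X Y) (X≢Y ∘ ratio≈1⇒ X Y)) ⟩
      γ * 0# ≈⟨ zeroʳ γ ⟩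
      0# ∎

    ω ω̄ : Carrier
    ω = ζ ^ p
    ω̄ = ζ̄ ^ p

    -- The exponent of ω in ω^⌊X/p⌋ η^(Xu).
    exponent : ℕ → ℕ → ℕ
    exponent X u = X / p ℕ.+ τ ℕ.* X ℕ.* u

    entry-term : ∀ X Y u → ω ^ exponent X u * ω̄ ^ exponent Y u ≈
      (ζ ^ (p ℕ.* (X / p)) * ζ̄ ^ (p ℕ.* (Y / p))) * ratio X Y ^ u
    entry-term X Y u = trans (*-cong (rebase ζ X) (rebase ζ̄ Y))
        (mixed-power (p ℕ.* (X / p)) (X ℕ.* t) (p ℕ.* (Y / p)) (Y ℕ.* t) u)
      where
      regroup : ∀ p a τ X u → p ℕ.* (a ℕ.+ τ ℕ.* X ℕ.* u) ≡ p ℕ.* a ℕ.+ X ℕ.* (p ℕ.* τ) ℕ.* u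
      regroup = solveℕ-∀
      rebase : ∀ x X → (x ^ p) ^ exponent X u ≈ x ^ (p ℕ.* (X / p) ℕ.+ X ℕ.* t ℕ.* u)
      rebase x X = trans (^-assocʳ x p (exponent X u)) (^-congʳ x (≡.trans (regroup p (X / p) τ X u)
        (cong (λ z → p ℕ.* (X / p) ℕ.+ X ℕ.* z ℕ.* u) (≡.sym t≡pτ))))

    -- The conjugates ζ η^u of ζ and their inverses.
    ξ ξ̄ : ℕ → Carrier
    ξ u = ζ ^ (1 ℕ.+ t ℕ.* u)
    ξ̄ u = ζ̄ ^ (1 ℕ.+ t ℕ.* u)

    conjugate-term : ∀ X Y u → ξ u ^ X * ξ̄ u ^ Y ≈ (ζ ^ X * ζ̄ ^ Y) * ratio X Y ^ u
    conjugate-term X Y u = trans (*-cong (rebase ζ X) (rebase ζ̄ Y))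
        (mixed-power X (X ℕ.* t) Y (Y ℕ.* t) u)
      where
      regroup : ∀ t u X → (1 ℕ.+ t ℕ.* u) ℕ.* X ≡ X ℕ.+ X ℕ.* t ℕ.* u
      regroup = solveℕ-∀
      rebase : ∀ x X → (x ^ (1 ℕ.+ t ℕ.* u)) ^ X ≈ x ^ (X ℕ.+ X ℕ.* t ℕ.* u)
      rebase x X = trans (^-assocʳ x (1 ℕ.+ t ℕ.* u) X) (^-congʳ x (regroup t u X))

    -- As X and Y leave the same remainder modulo p, the remaining powers of ζ and of its inverse
    -- cancel.
    reduce : ∀ X Y → X % p ≡ Y % p → ζ ^ X * ζ̄ ^ Y ≈ ζ ^ (p ℕ.* (X / p)) * ζ̄ ^ (p ℕ.* (Y / p))
    reduce X Y X≡Y = begin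
      ζ ^ X * ζ̄ ^ Y ≈⟨ *-cong (split ζ X (X % p) ≡.refl) (split ζ̄ Y (X % p) X≡Y) ⟩
      (ζ ^ (X % p) * ζ ^ (p ℕ.* (X / p))) * (ζ̄ ^ (X % p) * ζ̄ ^ (p ℕ.* (Y / p)))
        ≈⟨ interchange _ _ _ _ ⟩
      (ζ ^ (X % p) * ζ̄ ^ (X % p)) * (ζ ^ (p ℕ.* (X / p)) * ζ̄ ^ (p ℕ.* (Y / p)))
        ≈⟨ trans (*-congʳ (inverse-^ ζζ̄≈1 (X % p))) (*-identityˡ _) ⟩
      ζ ^ (p ℕ.* (X / p)) * ζ̄ ^ (p ℕ.* (Y / p)) ∎
      where
      split : ∀ x X r → r ≡ X % p → x ^ X ≈ x ^ r * x ^ (p ℕ.* (X / p))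
      split x X r ≡.refl = trans (^-congʳ x
          (≡.trans (m≡m%n+[m/n]*n X p) (cong (X % p ℕ.+_) (ℕ.*-comm (X / p) p))))
        (^-homo-* x (X % p) (p ℕ.* (X / p)))

    -- On both sides the terms are η^((X-Y)u) times a constant independent of u. For X ≡ Y modulo p
    -- the two constants coincide; otherwise both sums run over the powers of a nontrivial p-th root
    -- of unity and vanish. This trades the rounded exponents for conjugates of ζ.
    sum-entries : ∀ X Y → sum {p} (λ u → ω ^ exponent X (toℕ u) * ω̄ ^ exponent Y (toℕ u)) ≈
                          sum {p} (λ u → ξ (toℕ u) ^ X * ξ̄ (toℕ u) ^ Y)
    sum-entries X Y with X % p ℕ.≟ Y % p
    ... | yes X≡Y = sum-cong-≋ {p} (λ u → trans (entry-term X Y (toℕ u))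
      (trans (*-congʳ (sym (reduce X Y X≡Y))) (sym (conjugate-term X Y (toℕ u)))))
    ... | no X≢Y = begin
      sum {p} (λ u → ω ^ exponent X (toℕ u) * ω̄ ^ exponent Y (toℕ u))
        ≈⟨ sum-cong-≋ {p} (λ u → entry-term X Y (toℕ u)) ⟩
      sum {p} (λ u → (ζ ^ (p ℕ.* (X / p)) * ζ̄ ^ (p ℕ.* (Y / p))) * ratio X Y ^ toℕ u)
        ≈⟨ sum-ratio≈0 X Y X≢Y _ ⟩
      0# ≈⟨ sym (sum-ratio≈0 X Y X≢Y _) ⟩
      sum {p} (λ u → (ζ ^ X * ζ̄ ^ Y) * ratio X Y ^ toℕ u)
        ≈⟨ sum-cong-≋ {p} (λ u → sym (conjugate-term X Y (toℕ u))) ⟩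
      sum {p} (λ u → ξ (toℕ u) ^ X * ξ̄ (toℕ u) ^ Y) ∎

    -- The Gram matrix of H with ζ replaced by its conjugate `ξ u`.
    conjugate-product : Fin n → Fin n → ℕ → Carrier
    conjugate-product i l u = sum {n} (λ j → ξ u ^ toℕ (H i j) * ξ̄ u ^ toℕ (H l j))

    conjugate-diagonal : ∀ i u → conjugate-product i i u ≈ n · 1#
    conjugate-diagonal i u = trans
        (sum-cong-≋ {n} (λ j → inverse-^ (inverse-^ ζζ̄≈1 (1 ℕ.+ t ℕ.* u)) (toℕ (H i j))))
            (sum-replicate n)

    -- The entry (i, l) of the Gram matrix is an integer polynomial in ζ, because the inverse of ζ
    -- is a power of ζ. It vanishes at ζ by the hypothesis on H, hence at every ζ^(1+tu).
    conjugate-off-diagonal : ∀ {i l} → i ≢ l → ∀ u → conjugate-product i l u ≈ 0#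
    conjugate-off-diagonal {i} {l} i≢l u = vanishing-progression combf pp p∣t ≡.refl f1≈0 u
      where
      f : ℕ → Carrier
      f v = sum {n} (λ j → (ζ ^ v) ^ toℕ (H i j) * (ζ̄ ^ v) ^ toℕ (H l j))
      combf : Comb f
      combf = comb-sum λ j → comb-resp (λ v → begin
        (ζ ^ v) ^ toℕ (H i j) * (ζ̄ ^ v) ^ toℕ (H l j)
          ≈⟨ *-congˡ (^-congˡ (toℕ (H l j)) (^-swap ζ (k ℕ.∸ 1) v)) ⟩
        (ζ ^ v) ^ toℕ (H i j) * ((ζ ^ v) ^ (k ℕ.∸ 1)) ^ toℕ (H l j)
          ≈⟨ *-congˡ (^-assocʳ (ζ ^ v) (k ℕ.∸ 1) (toℕ (H l j))) ⟩
        (ζ ^ v) ^ toℕ (H i j) * (ζ ^ v) ^ ((k ℕ.∸ 1) ℕ.* toℕ (H l j))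
          ≈⟨ sym (^-homo-* (ζ ^ v) (toℕ (H i j)) ((k ℕ.∸ 1) ℕ.* toℕ (H l j))) ⟩
        (ζ ^ v) ^ (toℕ (H i j) ℕ.+ (k ℕ.∸ 1) ℕ.* toℕ (H l j)) ∎)
            (comb-χ (toℕ (H i j) ℕ.+ (k ℕ.∸ 1) ℕ.* toℕ (H l j)))
      f1≈0 : f 1 ≈ 0#
      f1≈0 = begin
        f 1
          ≈⟨ sum-cong-≋ {n} (λ j → *-cong (^-congˡ (toℕ (H i j)) (*-identityʳ ζ))
              (^-congˡ (toℕ (H l j)) (*-identityʳ ζ̄))) ⟩
        sum {n} (λ j → ζ ^ toℕ (H i j) * ζ̄ ^ toℕ (H l j))
          ≈⟨ sym (HHstar-inverse ζ^k≈1 ζζ̄≈1 H i l) ⟩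
        HHstar R k ζ H i l ≈⟨ isBH i l ⟩
        δ R n i l ≡⟨ δ-off-diagonal n i≢l ⟩
        0# ∎

    -- The entry ζ^a of H becomes the p × p block C^a F, where C is the companion
    -- matrix of x^p - ω and F the Fourier matrix; row s of C^a F has the entries
    -- ω^⌊(s+a)/p⌋ η^((s+a)u) with η = ω^(t/p).
    block : Fin p → Fin n → Fin p → Fin n → Fin t
    block s i u j = exponent (toℕ s ℕ.+ toℕ (H i j)) (toℕ u) mod t

    -- The position inside a block is the outer index and the index of `H` the inner one. Compared
    -- with the block matrix, this only permutes rows and columns.
    K : Fin (p ℕ.* n) → Fin (p ℕ.* n) → Fin t
    K r r′ = block (proj₁ (remQuot {p} n r)) (proj₂ (remQuot {p} n r)) (proj₁ (remQuot {p} n r′))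
        (proj₂ (remQuot {p} n r′))

    K-combine : ∀ s i u j → K (combine s i) (combine u j) ≡ block s i u j
    K-combine s i u j = cong₂ (λ x y → block (proj₁ x) (proj₂ x) (proj₁ y) (proj₂ y))
        (remQuot-combine s i) (remQuot-combine u j)

    ω^t≈1 : ω ^ t ≈ 1#
    ω^t≈1 = trans (^-assocʳ ζ p t) ζ^k≈1

    ω̄^t≈1 : ω̄ ^ t ≈ 1#
    ω̄^t≈1 = trans (^-assocʳ ζ̄ p t) (root-^ ζ k ζ^k≈1 (k ℕ.∸ 1))

    ^-mod : ∀ x → x ^ t ≈ 1# → ∀ e → x ^ toℕ (e mod t) ≈ x ^ e
    ^-mod x root e = trans (^-congʳ x (toℕ-fromℕ< (m%n<n e t))) (^-% x t root e)

    -- With the sum over u innermost, `sum-entries` turns the entries into powers of `ξ`. Exchanging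
    -- the sums back leaves, for each u, a factor coming from s and s′ times an entry of the Gram
    -- matrix of the conjugate of H.
    KKstar : ∀ s i s′ i′ → HHstar R t ω K (combine s i) (combine s′ i′) ≈
      sum {p} (λ u → (ξ (toℕ u) ^ toℕ s * ξ̄ (toℕ u) ^ toℕ s′) * conjugate-product i i′ (toℕ u))
    KKstar s i s′ i′ = begin
      HHstar R t ω K (combine s i) (combine s′ i′)
        ≈⟨ HHstar-inverse ω^t≈1 (inverse-^ ζζ̄≈1 p) K (combine s i) (combine s′ i′) ⟩
      sum {p ℕ.* n} (λ c → ω ^ toℕ (K (combine s i) c) * ω̄ ^ toℕ (K (combine s′ i′) c))
        ≈⟨ sum-combine p n _ ⟩
      sum {p} (λ u → sum {n} (λ j → ω ^ toℕ (K (combine s i) (combine u j)) *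
          ω̄ ^ toℕ (K (combine s′ i′) (combine u j))))
        ≈⟨ sum-cong-≋ {p} (λ u → sum-cong-≋ {n}
            (λ j → *-cong (entry ω ω^t≈1 s i u j) (entry ω̄ ω̄^t≈1 s′ i′ u j))) ⟩
      sum {p} (λ u → sum {n} (λ j → ω ^ exponent (X j) (toℕ u) * ω̄ ^ exponent (Y j) (toℕ u)))
        ≈⟨ ∑-comm {p} {n} (λ u j → ω ^ exponent (X j) (toℕ u) * ω̄ ^ exponent (Y j) (toℕ u)) ⟩
      sum {n} (λ j → sum {p} (λ u → ω ^ exponent (X j) (toℕ u) * ω̄ ^ exponent (Y j) (toℕ u)))
        ≈⟨ sum-cong-≋ {n} (λ j → sum-entries (X j) (Y j)) ⟩
      sum {n} (λ j → sum {p} (λ u → ξ (toℕ u) ^ X j * ξ̄ (toℕ u) ^ Y j))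
        ≈⟨ ∑-comm {n} {p} (λ j u → ξ (toℕ u) ^ X j * ξ̄ (toℕ u) ^ Y j) ⟩
      sum {p} (λ u → sum {n} (λ j → ξ (toℕ u) ^ X j * ξ̄ (toℕ u) ^ Y j))
        ≈⟨ sum-cong-≋ {p} (λ u → trans
             (sum-cong-≋ {n} (λ j → split (toℕ u) j))
             (sym (*-distribˡ-sum {n} (row (toℕ u))
                 (λ j → ξ (toℕ u) ^ toℕ (H i j) * ξ̄ (toℕ u) ^ toℕ (H i′ j))))) ⟩
      sum {p} (λ u → row (toℕ u) * conjugate-product i i′ (toℕ u)) ∎
      where
      X Y : Fin n → ℕ
      X j = toℕ s ℕ.+ toℕ (H i j)
      Y j = toℕ s′ ℕ.+ toℕ (H i′ j)
      row : ℕ → Carrier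
      row u = ξ u ^ toℕ s * ξ̄ u ^ toℕ s′
      entry : ∀ x → x ^ t ≈ 1# → ∀ s i u j →
        x ^ toℕ (K (combine s i) (combine u j)) ≈ x ^ exponent (toℕ s ℕ.+ toℕ (H i j)) (toℕ u)
      entry x root s i u j = trans (^-congʳ x (cong toℕ (K-combine s i u j)))
          (^-mod x root (exponent (toℕ s ℕ.+ toℕ (H i j)) (toℕ u)))
      split : ∀ u j → ξ u ^ X j * ξ̄ u ^ Y j ≈ row u * (ξ u ^ toℕ (H i j) * ξ̄ u ^ toℕ (H i′ j))
      split u j = trans (*-cong (^-homo-* (ξ u) (toℕ s) (toℕ (H i j)))
          (^-homo-* (ξ̄ u) (toℕ s′) (toℕ (H i′ j)))) (interchange _ _ _ _)

    KKstar-diagonal : ∀ s i → HHstar R t ω K (combine s i) (combine s i) ≈ (p ℕ.* n) · 1#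
    KKstar-diagonal s i = begin
      HHstar R t ω K (combine s i) (combine s i) ≈⟨ KKstar s i s i ⟩
      sum {p} (λ u → (ξ (toℕ u) ^ toℕ s * ξ̄ (toℕ u) ^ toℕ s) * conjugate-product i i (toℕ u))
        ≈⟨ sum-cong-≋ {p} (λ u → trans
            (*-cong (inverse-^ (inverse-^ ζζ̄≈1 (1 ℕ.+ t ℕ.* toℕ u)) (toℕ s))
                (conjugate-diagonal i (toℕ u))) (*-identityˡ _)) ⟩
      sum {p} (λ _ → n · 1#) ≈⟨ sum-replicate p ⟩
      p · (n · 1#) ≈⟨ ×-assocˡ 1# p n ⟩
      (p ℕ.* n) · 1# ∎

    -- For i ≠ i′ every conjugate product vanishes. For i = i′ each of them is n, and what remains
    -- is a multiple of Σ η^((s-s′)u), which is zero because s and s′ are distinct residues modulo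
    -- p.
    KKstar-off-diagonal : ∀ s i s′ i′ → i ≢ i′ ⊎ s ≢ s′ →
        HHstar R t ω K (combine s i) (combine s′ i′) ≈ 0#
    KKstar-off-diagonal s i s′ i′ (inj₁ i≢i′) = trans (KKstar s i s′ i′)
      (sum-zero {p} _ (λ u → trans (*-congˡ (conjugate-off-diagonal i≢i′ (toℕ u))) (zeroʳ _)))
    KKstar-off-diagonal s i s′ i′ (inj₂ s≢s′) with i ≟ᶠ i′
    ... | no i≢i′ = KKstar-off-diagonal s i s′ i′ (inj₁ i≢i′)
    ... | yes ≡.refl = begin
      HHstar R t ω K (combine s i) (combine s′ i) ≈⟨ KKstar s i s′ i ⟩
      sum {p} (λ u → (ξ (toℕ u) ^ toℕ s * ξ̄ (toℕ u) ^ toℕ s′) * conjugate-product i i (toℕ u))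
        ≈⟨ sum-cong-≋ {p} (λ u → *-cong (conjugate-term (toℕ s) (toℕ s′) (toℕ u))
            (conjugate-diagonal i (toℕ u))) ⟩
      sum {p} (λ u → ((ζ ^ toℕ s * ζ̄ ^ toℕ s′) * ratio (toℕ s) (toℕ s′) ^ toℕ u) * (n · 1#))
        ≈⟨ sym (*-distribʳ-sum {p} (n · 1#)
            (λ u → (ζ ^ toℕ s * ζ̄ ^ toℕ s′) * ratio (toℕ s) (toℕ s′) ^ toℕ u)) ⟩
      sum {p} (λ u → (ζ ^ toℕ s * ζ̄ ^ toℕ s′) * ratio (toℕ s) (toℕ s′) ^ toℕ u) * (n · 1#)
        ≈⟨ *-congʳ (sum-ratio≈0 (toℕ s) (toℕ s′) residues≢ _) ⟩
      0# * (n · 1#) ≈⟨ zeroˡ _ ⟩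
      0# ∎
      where
      residues≢ : toℕ s % p ≢ toℕ s′ % p
      residues≢ eq = s≢s′ (toℕ-injective
          (≡.trans (≡.sym (m<n⇒m%n≡m (toℕ<n s))) (≡.trans eq (m<n⇒m%n≡m (toℕ<n s′)))))

    isBH-combine : ∀ s i s′ i′ → HHstar R t ω K (combine s i) (combine s′ i′) ≈
        δ R (p ℕ.* n) (combine s i) (combine s′ i′)
    isBH-combine s i s′ i′ with i ≟ᶠ i′ | s ≟ᶠ s′
    ... | yes ≡.refl | yes ≡.refl = trans (KKstar-diagonal s i)
      (sym (reflexive (≡.trans (δ-diagonal (p ℕ.* n) (combine s i)) (natR≡× (p ℕ.* n)))))
    ... | no i≢i′ | _ = trans (KKstar-off-diagonal s i s′ i′ (inj₁ i≢i′))
      (sym (reflexive (δ-off-diagonal (p ℕ.* n) (i≢i′ ∘ combine-injectiveʳ s i s′ i′))))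
    ... | _ | no s≢s′ = trans (KKstar-off-diagonal s i s′ i′ (inj₂ s≢s′))
      (sym (reflexive (δ-off-diagonal (p ℕ.* n) (s≢s′ ∘ combine-injectiveˡ s i s′ i′))))

    isBH-K : IsBH R (p ℕ.* n) t ω K
    isBH-K r r′ = subst₂ (λ r r′ → HHstar R t ω K r r′ ≈ δ R (p ℕ.* n) r r′)
      (combine-remQuot {p} n r) (combine-remQuot {p} n r′) (isBH-combine _ _ _ _)

  -- From prime factors to arbitrary m.

  prime-step : ∀ {p t n ζ} → Prime p → p ∣ t → .{{_ : NonZero t}} → IsPrimitiveRoot R (p ℕ.* t) ζ →
               BHNonempty R n (p ℕ.* t) ζ → BHNonempty R (p ℕ.* n) t (ζ ^ p)
  prime-step {ζ = ζ} pp p∣t prim (H , isBH) = K , isBH-K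
    where open PrimeStep pp p∣t ζ prim H isBH

  primitive-^ : ∀ {p t ζ} .{{_ : NonZero p}} → IsPrimitiveRoot R (p ℕ.* t) ζ →
      IsPrimitiveRoot R t (ζ ^ p)
  primitive-^ {p} {t} {ζ} prim = record
    { root = trans (power t) (IsPrimitiveRoot.root prim)
    ; isPrimitive = λ j 0<j j<t eq → IsPrimitiveRoot.isPrimitive prim (p ℕ.* j)
        (ℕ.>-nonZero⁻¹ (p ℕ.* j) {{ℕ.m*n≢0 p j {{it}} {{ℕ.>-nonZero 0<j}}}}) (ℕ.*-monoʳ-< p j<t)
            (trans (sym (power j)) eq)
    }
    where
    power : ∀ j → pow R (ζ ^ p) j ≈ pow R ζ (p ℕ.* j)
    power j = trans (reflexive (pow≡^ (ζ ^ p) j))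
        (trans (^-assocʳ ζ p j) (reflexive (≡.sym (pow≡^ ζ (p ℕ.* j)))))

  nonempty-cong : ∀ {n n′ k k′ x y} → n ≡ n′ → k ≡ k′ → x ≈ y → BHNonempty R n k x →
      BHNonempty R n′ k′ y
  nonempty-cong ≡.refl ≡.refl x≈y (H , isBH) = H , λ i l →
      trans (sym (HHstar-cong x≈y H i l)) (isBH i l)

  -- One prime factor after the other moves from the order of the roots of unity to the size of the
  -- matrix, while ζ is replaced by ζ^p.
  descend : ∀ {t} .{{_ : NonZero t}} ps → All Prime ps →
      (∀ p → Prime p → p ∣ product ps ℕ.* t → p ∣ t) →
    ∀ {n ζ} → IsPrimitiveRoot R (product ps ℕ.* t) ζ → BHNonempty R n (product ps ℕ.* t) ζ →
    BHNonempty R (product ps ℕ.* n) t (ζ ^ product ps)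
  descend {t} [] [] radical {n} {ζ} prim =
    nonempty-cong (≡.sym (ℕ.*-identityˡ n)) (ℕ.*-identityˡ t) (sym (*-identityʳ ζ))
  descend {t} (p ∷ ps) (pp ∷ pps) radical {n} {ζ} prim nonempty =
    nonempty-cong (regroup p (product ps) n) ≡.refl (^-assocʳ ζ p (product ps))
      (descend ps pps (λ q pq q∣ → radical q pq (subst (q ∣_) (≡.sym assoc) (∣n⇒∣m*n p q∣)))
        (primitive-^ {p} prim′)
        -- By `radical` the prime `p` divides `t`, hence also the order `product ps * t` that is
        -- left after this step.
        (prime-step pp (∣n⇒∣m*n (product ps) (radical p pp (∣m⇒∣m*n t (m∣m*n (product ps)))))
          prim′ (nonempty-cong ≡.refl assoc refl nonempty)))
    where
    regroup : ∀ p m n → m ℕ.* (p ℕ.* n) ≡ p ℕ.* m ℕ.* n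
    regroup = solveℕ-∀
    assoc : p ℕ.* product ps ℕ.* t ≡ p ℕ.* (product ps ℕ.* t)
    assoc = ℕ.*-assoc p (product ps) t
    prim′ : IsPrimitiveRoot R (p ℕ.* (product ps ℕ.* t)) ζ
    prim′ = subst (λ k → IsPrimitiveRoot R k ζ) assoc prim
    instance
      p≢0 : NonZero p
      p≢0 = prime⇒nonZero pp
      rest≢0 : NonZero (product ps ℕ.* t)
      rest≢0 = ℕ.m*n≢0 (product ps) t {{productOfPrimes≢0 pps}}

open import Data.Nat using (_*_; _<_)

theorem1p2 : ∀ {c ℓ} (R : CommutativeRing c ℓ) → CharZeroDomain R →
    (n m t : ℕ) → 0 < n → 0 < m → 0 < t →
    (∀ p → Prime p → p ∣ m * t → p ∣ t) →
    (ζ : CommutativeRing.Carrier R) → IsPrimitiveRoot R (m * t) ζ →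
    BHNonempty R n (m * t) ζ →
    BHNonempty R (m * n) t (pow R ζ m)
theorem1p2 R dom n m@(suc _) t@(suc _) _ _ _ radical ζ prim nonempty =
  nonempty-cong (cong (_* n) (≡.sym isFactorisation)) ≡.refl
    (reflexive (≡.trans (cong (ζ ^_) (≡.sym isFactorisation)) (≡.sym (pow≡^ ζ m))))
    (descend factors factorsPrime
      (λ p pp p∣ → radical p pp (subst (λ m → p ∣ m * t) (≡.sym isFactorisation) p∣))
      (subst (λ m → IsPrimitiveRoot R (m * t) ζ) isFactorisation prim)
      (subst (λ m → BHNonempty R n (m * t) ζ) isFactorisation nonempty))
  where
  open PrimeFactorisation (factorise m)
  open Matrices R dom
  open Domain R dom using (pow≡^)
  open CommutativeRing R using (reflexive)
  open import Algebra.Properties.Semiring.Exp (CommutativeRing.semiring R) using (_^_)
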